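{- Let $\mathcal{F}$ be a class of graphs. The following statements are equivalent: (i) $\mathcal{F}$ has bounded star choice number; (ii) $\mathcal{F}$ has bounded arrangeability; (iii) there is a constant $C_\mathcal{F}$ such that every $G\in\mathcal{F}$ and every neighborhood system $\Sigma$ for $G$ satisfy $\mathit{ch}(\Sigma)\le C_\mathcal{F}\cdot\rho(\Sigma)$; (iv) there is a function $f_\mathcal{F}$ such that every $G\in\mathcal{F}$ and every neighborhood system $\Sigma$ for $G$ satisfy $\mathit{ch}(\Sigma)\le f_\mathcal{F}(\rho(\Sigma))$; (v) the supremum of $\mathit{ch}(\Sigma)$ over all $G\in\mathcal{F}$ and all neighborhood systems $\Sigma$ for $G$ with $\rho(\Sigma)=2$ is finite.
   Context: Graphs are finite and simple. For a graph $G=(V,E)$, a neighborhood system for $G$ is a collection $(\Sigma(v))_{v\in V}$ with $\Sigma(v)\subseteq N(v)$ (the set of neighbors of $v$), and $\rho(\Sigma)=\max_v|\Sigma(v)|$. Given lists $L(v)$ of colors, a $\Sigma$-$L$-coloring assigns each $v$ a color from $L(v)$ so that any two distinct vertices lying together in some $\Sigma(w)$ get different colors; $\mathit{ch}(\Sigma)$ is the minimum $k$ such that for every assignment of lists of size at least $k$ there is a $\Sigma$-$L$-coloring. A star coloring of $G$ is a proper coloring in which every two color classes induce a forest of stars; the star choice number $\mathit{ch}_s(G)$ is the minimum $k$ such that for every assignment of lists of size at least $k$ to the vertices, $G$ has a star coloring with each vertex colored from its list. The arrangeability of $G$ is the least $k$ such that there is a linear ordering $\prec$ of $V(G)$ such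 that for every vertex $v$, there are at most $k$ vertices $u\prec v$ having a common neighbor $w$ with $v$ such that $v\prec w$. A class has bounded star choice number (resp. bounded arrangeability) if this parameter is bounded by a constant over all graphs of the class.
   Formalization: Condition (iii) is required only for neighborhood systems with ρ(Σ) ≥ 1: if all Σ(v) are empty on a nonempty graph, then ρ(Σ) = 0 but ch(Σ) = 1, so ch(Σ) ≤ C·ρ(Σ) fails for every C and the equivalence would be false as written. -}

module Defs where

open import Data.Nat using (ℕ; zero; suc; _+_; _*_; _≤_; _<ᵇ_; _⊔_)
open import Data.Bool using (Bool; true; false; _∧_)
open import Data.Fin using (Fin; toℕ)
open import Data.List using (List; length; foldr; map; allFin)
open import Data.Bool.ListAction using (any)
open import Data.Vec using (tabulate)
open import Data.Fin.Subset using (∣_∣)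
open import Data.List.Membership.Propositional using (_∈_)
open import Data.List.Relation.Unary.Unique.Propositional using (Unique)
open import Data.Product using (Σ; ∃; _×_)
open import Data.Sum using (_⊎_)
open import Relation.Binary.PropositionalEquality using (_≡_; _≢_)
open import Function.Definitions using (Injective)

record Graph : Set where
  field
    n     : ℕ
    adj   : Fin n → Fin n → Bool
    sym   : ∀ u v → adj u v ≡ adj v u
    irrefl : ∀ v → adj v v ≡ false
open Graph public

card : {m : ℕ} → (Fin m → Bool) → ℕ
card p = ∣ tabulate p ∣

record NbhdSystem (G : Graph) : Set where
  field
    mem    : Fin (n G) → Fin (n G) → Bool
    sub    : ∀ v u → mem v u ≡ true → adj G v u ≡ true
open NbhdSystem public

-- ρ(Σ) = max_v |Σ(v)|   (0 for the empty graph)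
ρ : {G : Graph} → NbhdSystem G → ℕ
ρ {G} S = foldr _⊔_ 0 (map (λ v → card (mem S v)) (allFin (n G)))

ListAssignment : Graph → ℕ → Set
ListAssignment G k = Σ (Fin (n G) → List ℕ) λ L →
  ∀ v → Unique (L v) × k ≤ length (L v)

FromLists : (G : Graph) → (Fin (n G) → List ℕ) → (Fin (n G) → ℕ) → Set
FromLists G L c = ∀ v → c v ∈ L v

IsΣColoring : {G : Graph} → NbhdSystem G → (Fin (n G) → ℕ) → Set
IsΣColoring {G} S c = ∀ w u u' → mem S w u ≡ true → mem S w u' ≡ true →
  u ≢ u' → c u ≢ c u'

ChΣ≤ : {G : Graph} → NbhdSystem G → ℕ → Set
ChΣ≤ {G} S k = (LA : ListAssignment G k) →
  ∃ λ c → FromLists G (Data.Product.proj₁ LA) c × IsΣColoring S c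

IsProper : (G : Graph) → (Fin (n G) → ℕ) → Set
IsProper G c = ∀ u v → adj G u v ≡ true → c u ≢ c v

-- A vertex-induced subgraph (vertices satisfying P) is a forest of stars:
-- every edge of it has an endpoint of degree one in it.
LeafIn : (G : Graph) → (Fin (n G) → Set) → Fin (n G) → Fin (n G) → Set
LeafIn G P x y = ∀ z → P z → adj G x z ≡ true → z ≡ y

InducedStarForest : (G : Graph) → (Fin (n G) → Set) → Set
InducedStarForest G P = ∀ x y → P x → P y → adj G x y ≡ true →
  LeafIn G P x y ⊎ LeafIn G P y x

IsStarColoring : (G : Graph) → (Fin (n G) → ℕ) → Set
IsStarColoring G c = IsProper G c ×
  (∀ i j → i ≢ j → InducedStarForest G (λ v → c v ≡ i ⊎ c v ≡ j))

ChStar≤ : Graph → ℕ → Set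
ChStar≤ G k = (LA : ListAssignment G k) →
  ∃ λ c → FromLists G (Data.Product.proj₁ LA) c × IsStarColoring G c

-- Arrangeability: linear order given by an injective position map pos.
anyFin : {m : ℕ} → (Fin m → Bool) → Bool
anyFin {m} p = any p (allFin m)

backCount : (G : Graph) → (Fin (n G) → Fin (n G)) → Fin (n G) → ℕ
backCount G pos v = card λ u → (toℕ (pos u) <ᵇ toℕ (pos v)) ∧
  anyFin (λ w → adj G u w ∧ adj G v w ∧ (toℕ (pos v) <ᵇ toℕ (pos w)))

Arrangeability≤ : Graph → ℕ → Set
Arrangeability≤ G k = ∃ λ (pos : Fin (n G) → Fin (n G)) →
  Injective _≡_ _≡_ pos × (∀ v → backCount G pos v ≤ k)

GraphClass : Set₁
GraphClass = Graph → Set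

BoundedStarChoice : GraphClass → Set
BoundedStarChoice F = ∃ λ k → ∀ G → F G → ChStar≤ G k

BoundedArrangeability : GraphClass → Set
BoundedArrangeability F = ∃ λ k → ∀ G → F G → Arrangeability≤ G k

LinearChBound : GraphClass → Set
LinearChBound F = ∃ λ C → ∀ G → F G → (S : NbhdSystem G) → 1 ≤ ρ S →
  ChΣ≤ S (C * ρ S)

FunctionChBound : GraphClass → Set
FunctionChBound F = ∃ λ (f : ℕ → ℕ) → ∀ G → F G → (S : NbhdSystem G) →
  ChΣ≤ S (f (ρ S))

Rho2ChBound : GraphClass → Set
Rho2ChBound F = ∃ λ K → ∀ G → F G → (S : NbhdSystem G) → ρ S ≡ 2 →
  ChΣ≤ S K

{-# OPTIONS --safe #-}

-- Bounded arrangeability gives the colourings greedily: along the order, a vertex has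
-- boundedly many earlier vertices to avoid.
--
-- Conversely, try to build an order from its end, always removing from the set M of
-- remaining vertices one with few neighbours in M and few vertices of M reachable
-- through an already removed vertex. If this gets stuck, half of M has many neighbours
-- in M, or half of M has many such hops while every removed vertex has few neighbours
-- in M. In both cases a random colouring (derandomized by conditional expectations)
-- finds vertex sets A and B, with A much larger than B, such that every vertex of A
-- is joined to all of k colour classes of B, by edges or by paths through removed vertices.
-- Give the classes of B disjoint lists and each vertex of A a transversal of them. Any
-- colouring of B can be killed at a given a ∈ A by one of boundedly many transversals,
-- so, averaging over the survivors, one choice of transversals for the many vertices
-- of A kills all the colourings of the few vertices of B.

module Submission where

open import Defs hiding (n; sym)
open import Data.Bool using (Bool; true; false; if_then_else_; T; _∧_)
import Data.Bool.Properties as Boolₚ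
open import Data.Fin using (Fin; zero; suc; toℕ; fromℕ<; combine; remQuot; _↑ˡ_; _↑ʳ_; finToFun; funToFin)
import Data.Fin as Fin
import Data.Fin.Properties as Finₚ
open import Data.Fin.Properties using (any?; all?; remQuot-combine; finToFun-funToFin; toℕ-injective)
open import Data.List using (List; []; _∷_; length; map; allFin; foldr)
open import Data.List.Membership.Propositional using (_∈_; lose)
open import Data.List.Membership.Propositional.Properties using (∈-map⁻; ∈-allFin)
open import Data.List.Properties using (length-map; length-tabulate)
import Data.List.Relation.Unary.All as All
open import Data.List.Relation.Unary.AllPairs using (_∷_)
import Data.List.Relation.Unary.Any as Any
open import Data.List.Relation.Unary.Any using (here; there)
open import Data.List.Relation.Unary.Any.Properties using (any⁺; any⁻)
open import Data.List.Relation.Unary.Unique.Propositional using (Unique)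
open import Data.List.Relation.Unary.Unique.Propositional.Properties using (map⁺; allFin⁺)
open import Data.Maybe using (Maybe; just; nothing)
open import Data.Maybe.Properties using (just-injective; ≡-dec)
open import Data.Nat
open import Data.Nat.Properties
open import Data.Nat.Tactic.RingSolver using (solve-∀)
open import Data.Product hiding (map)
open import Data.Sum using (_⊎_; inj₁; inj₂; [_,_]′)
open import Data.Unit using (⊤; tt)
open import Function using (_∘_; id)
open import Function.Bundles using (_⇔_; mk⇔; Equivalence)
open import Function.Definitions using (Injective)
open import Relation.Binary using (tri<; tri≈; tri>)
open import Relation.Binary.PropositionalEquality
open import Relation.Nullary
open import Relation.Nullary.Decidable using (dec-true; dec-false)
open import Relation.Unary using (Decidable)
open import Algebra.Properties.Semiring.Sum +-*-semiring
  using (sum; ∑-comm; ∑-distrib-+; *-distribˡ-sum; *-distribʳ-sum; sum-cong-≗)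

private variable
  n m p k : ℕ

-- Counting

⟦_⟧ : {P : Set} → Dec P → ℕ
⟦ P? ⟧ = if does P? then 1 else 0

⟦⟧-true : {P : Set} (P? : Dec P) → P → ⟦ P? ⟧ ≡ 1
⟦⟧-true P? p = cong (if_then 1 else 0) (dec-true P? p)

⟦⟧-false : {P : Set} (P? : Dec P) → ¬ P → ⟦ P? ⟧ ≡ 0
⟦⟧-false P? ¬p = cong (if_then 1 else 0) (dec-false P? ¬p)

⟦⟧-≤ : {P : Set} (P? : Dec P) {x : ℕ} → (P → 1 ≤ x) → ⟦ P? ⟧ ≤ x
⟦⟧-≤ (yes p) 1≤x = 1≤x p
⟦⟧-≤ (no _)  _   = z≤n

# : {P : Fin n → Set} → Decidable P → ℕ
# P? = sum (λ i → ⟦ P? i ⟧)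

sum-mono : {f g : Fin n → ℕ} → (∀ i → f i ≤ g i) → sum f ≤ sum g
sum-mono {zero}  f≤g = z≤n
sum-mono {suc n} f≤g = +-mono-≤ (f≤g zero) (sum-mono (f≤g ∘ suc))

sum-const : ∀ n c → sum {n} (λ _ → c) ≡ n * c
sum-const zero    c = refl
sum-const (suc n) c = cong (c +_) (sum-const n c)

term≤sum : (f : Fin n → ℕ) (i : Fin n) → f i ≤ sum f
term≤sum f zero    = m≤m+n _ _
term≤sum f (suc i) = ≤-trans (term≤sum (f ∘ suc) i) (m≤n+m _ _)

sum-+ : ∀ m {n} (f : Fin (m + n) → ℕ) → sum f ≡ sum (λ i → f (i ↑ˡ n)) + sum (λ j → f (m ↑ʳ j))
sum-+ zero    f = refl
sum-+ (suc m) f = trans (cong (f zero +_) (sum-+ m (f ∘ suc))) (sym (+-assoc (f zero) _ _))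

sum-combine : ∀ n {m} (f : Fin (n * m) → ℕ) → sum f ≡ sum (λ (i : Fin n) → sum (λ (j : Fin m) → f (combine i j)))
sum-combine zero        f = refl
sum-combine (suc n) {m} f = trans (sum-+ m f) (cong (sum (λ j → f (j ↑ˡ (n * m))) +_) (sum-combine n (λ i → f (m ↑ʳ i))))

average : (f : Fin (suc n) → ℕ) → ∃ λ i → suc n * f i ≤ sum f
average {zero}  f = zero , ≤-refl
average {suc n} f with average (f ∘ suc)
... | i , h with f zero ≤? f (suc i)
... | yes f₀≤fᵢ = zero , +-monoʳ-≤ (f zero) (≤-trans (*-monoʳ-≤ (suc n) f₀≤fᵢ) h)
... | no  f₀≰fᵢ = suc i , +-mono-≤ (<⇒≤ (≰⇒> f₀≰fᵢ)) h

module _ {P Q : Fin n → Set} (P? : Decidable P) (Q? : Decidable Q) where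

  ⟦⟧-mono : (∀ i → P i → Q i) → ∀ i → ⟦ P? i ⟧ ≤ ⟦ Q? i ⟧
  ⟦⟧-mono P⇒Q i with P? i | Q? i
  ... | no  _ | _     = z≤n
  ... | yes _ | yes _ = ≤-refl
  ... | yes p | no ¬q = contradiction (P⇒Q i p) ¬q

  #-mono : (∀ i → P i → Q i) → # P? ≤ # Q?
  #-mono P⇒Q = sum-mono (⟦⟧-mono P⇒Q)

#-∪ : {P Q R : Fin n → Set} (P? : Decidable P) (Q? : Decidable Q) (R? : Decidable R) →
      (∀ i → P i → Q i ⊎ R i) → # P? ≤ # Q? + # R?
#-∪ P? Q? R? P⇒Q∪R = ≤-trans (sum-mono step) (≤-reflexive (∑-distrib-+ (λ i → ⟦ Q? i ⟧) (λ i → ⟦ R? i ⟧)))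
  where
  step : ∀ i → ⟦ P? i ⟧ ≤ ⟦ Q? i ⟧ + ⟦ R? i ⟧
  step i with P? i | Q? i | R? i
  ... | no _  | _     | _     = z≤n
  ... | yes _ | yes _ | _     = s≤s z≤n
  ... | yes _ | no _  | yes _ = s≤s z≤n
  ... | yes p | no ¬q | no ¬r = [ (λ q → contradiction q ¬q) , (λ r → contradiction r ¬r) ]′ (P⇒Q∪R i p)

#-⊎ : {P Q R : Fin n → Set} (P? : Decidable P) (Q? : Decidable Q) (R? : Decidable R) →
      (∀ i → Q i → P i) → (∀ i → R i → P i) → (∀ i → Q i → ¬ R i) → # Q? + # R? ≤ # P?
#-⊎ P? Q? R? Q⇒P R⇒P Q∩R=∅ = ≤-trans (≤-reflexive (sym (∑-distrib-+ (λ i → ⟦ Q? i ⟧) (λ i → ⟦ R? i ⟧)))) (sum-mono step)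
  where
  step : ∀ i → ⟦ Q? i ⟧ + ⟦ R? i ⟧ ≤ ⟦ P? i ⟧
  step i with P? i | Q? i | R? i
  ... | _     | no _  | no _  = z≤n
  ... | yes _ | yes _ | no _  = ≤-refl
  ... | yes _ | no _  | yes _ = ≤-refl
  ... | no ¬p | yes q | _     = contradiction (Q⇒P i q) ¬p
  ... | no ¬p | _     | yes r = contradiction (R⇒P i r) ¬p
  ... | _     | yes q | yes r = contradiction r (Q∩R=∅ i q)

#-all : {P : Fin n → Set} (P? : Decidable P) → (∀ i → P i) → # P? ≡ n
#-all {n} P? ∀P = trans (sum-cong-≗ (λ i → ⟦⟧-true (P? i) (∀P i))) (trans (sum-const n 1) (*-identityʳ n))

#-∁ : {P : Fin n → Set} (P? : Decidable P) → # P? + # (¬? ∘ P?) ≡ n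
#-∁ {n} P? = trans (sym (∑-distrib-+ (λ i → ⟦ P? i ⟧) (λ i → ⟦ ¬? (P? i) ⟧)))
  (trans (sum-cong-≗ step) (trans (sum-const n 1) (*-identityʳ n)))
  where
  step : ∀ i → ⟦ P? i ⟧ + ⟦ ¬? (P? i) ⟧ ≡ 1
  step i with P? i
  ... | yes _ = refl
  ... | no _  = refl

#-≡ : (i : Fin n) → # (Finₚ._≟ i) ≡ 1
#-≡ {suc n} zero = cong suc (trans (sum-cong-≗ (λ j → ⟦⟧-false (suc {n} j Finₚ.≟ zero) λ ())) (trans (sum-const n 0) (*-zeroʳ n)))
#-≡ (suc i) = trans (sum-cong-≗ step) (#-≡ i)
  where
  step : ∀ j → ⟦ suc j Finₚ.≟ suc i ⟧ ≡ ⟦ j Finₚ.≟ i ⟧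
  step j with j Finₚ.≟ i
  ... | yes _ = refl
  ... | no _  = refl

module _ {P : Fin n → Set} (P? : Decidable P) where

  ∃⇒1≤# : ∃ P → 1 ≤ # P?
  ∃⇒1≤# (i , p) = ≤-trans (≤-reflexive (sym (⟦⟧-true (P? i) p))) (term≤sum (λ i → ⟦ P? i ⟧) i)

  1≤#⇒∃ : 1 ≤ # P? → ∃ P
  1≤#⇒∃ 1≤# with any? P?
  ... | yes ∃P = ∃P
  ... | no ¬∃P = contradiction (≤-trans 1≤# (≤-reflexive #≡0)) λ ()
    where
    #≡0 : # P? ≡ 0
    #≡0 = trans (sum-cong-≗ (λ i → ⟦⟧-false (P? i) (λ p → ¬∃P (i , p)))) (trans (sum-const n 0) (*-zeroʳ n))

#-⋃ : {P : Fin m → Set} (P? : Decidable P) {Q : Fin m → Fin n → Set} (Q? : ∀ i → Decidable (Q i))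
      {R : Fin n → Set} (R? : Decidable R) (c : ℕ) →
      (∀ j → R j → ∃ λ i → P i × Q i j) → (∀ i → P i → # (Q? i) ≤ c) → # R? ≤ # P? * c
#-⋃ {m} {n} {P} P? Q? {R} R? c R⊆ Q≤ = begin
  sum (λ j → ⟦ R? j ⟧)                               ≤⟨ sum-mono step₁ ⟩
  sum (λ j → sum (λ i → ⟦ P? i ⟧ * ⟦ Q? i j ⟧))      ≡⟨ ∑-comm (λ j i → ⟦ P? i ⟧ * ⟦ Q? i j ⟧) ⟩
  sum (λ i → sum (λ j → ⟦ P? i ⟧ * ⟦ Q? i j ⟧))      ≡⟨ sum-cong-≗ (λ i → *-distribˡ-sum ⟦ P? i ⟧ (λ j → ⟦ Q? i j ⟧)) ⟨
  sum (λ i → ⟦ P? i ⟧ * # (Q? i))                    ≤⟨ sum-mono step₂ ⟩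
  sum (λ i → ⟦ P? i ⟧ * c)                           ≡⟨ *-distribʳ-sum c (λ i → ⟦ P? i ⟧) ⟨
  # P? * c                                           ∎
  where
  open ≤-Reasoning
  step₁ : ∀ j → ⟦ R? j ⟧ ≤ sum (λ i → ⟦ P? i ⟧ * ⟦ Q? i j ⟧)
  step₁ j = ⟦⟧-≤ (R? j) λ r → let i , p , q = R⊆ j r in
    ≤-trans (≤-reflexive (sym (cong₂ _*_ (⟦⟧-true (P? i) p) (⟦⟧-true (Q? i j) q))))
            (term≤sum (λ i → ⟦ P? i ⟧ * ⟦ Q? i j ⟧) i)
  step₂ : ∀ i → ⟦ P? i ⟧ * # (Q? i) ≤ ⟦ P? i ⟧ * c
  step₂ i with P? i
  ... | no _  = z≤n
  ... | yes p = *-monoʳ-≤ 1 (Q≤ i p)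

#-fibres : {P : Fin n → Set} (P? : Decidable P) (f : Fin n → Fin m) →
           sum (λ x → # (λ i → P? i ×-dec (f i Finₚ.≟ x))) ≡ # P?
#-fibres {n} {m} P? f = trans (∑-comm (λ x i → ⟦ P? i ×-dec (f i Finₚ.≟ x) ⟧)) (sum-cong-≗ step)
  where
  step : ∀ i → sum (λ x → ⟦ P? i ×-dec (f i Finₚ.≟ x) ⟧) ≡ ⟦ P? i ⟧
  step i with P? i
  ... | no _ = trans (sum-const m 0) (*-zeroʳ m)
  ... | yes _ = trans (sum-cong-≗ flip≟) (#-≡ (f i))
    where
    flip≟ : ∀ x → ⟦ f i Finₚ.≟ x ⟧ ≡ ⟦ x Finₚ.≟ f i ⟧
    flip≟ x with f i Finₚ.≟ x | x Finₚ.≟ f i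
    ... | yes _ | yes _ = refl
    ... | no _  | no _  = refl
    ... | yes e | no ¬e = contradiction (sym e) ¬e
    ... | no ¬e | yes e = contradiction (sym e) ¬e

-- Derandomization

-- A target wishes for one colour at some vertices and has `nothing` at the others; a colouring hits
-- it by fulfilling at least one wish.
Target : ℕ → ℕ → Set
Target n m = Fin n → Maybe (Fin m)

_≟ᴹ_ : (x y : Maybe (Fin m)) → Dec (x ≡ y)
_≟ᴹ_ = ≡-dec Finₚ._≟_

Hits : (Fin n → Fin m) → Target n m → Set
Hits χ t = ∃ λ v → t v ≡ just (χ v)

hits? : (χ : Fin n → Fin m) → Decidable (Hits χ)
hits? χ t = any? (λ v → t v ≟ᴹ just (χ v))

-- weight t / suc m ^ n is the probability that a uniformly random χ misses t.
missing : Maybe (Fin (suc m)) → ℕ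
missing {m} (just _) = m
missing {m} nothing  = suc m

weight : Target n (suc m) → ℕ
weight {zero}  t = 1
weight {suc n} t = missing (t zero) * weight (t ∘ suc)

sum-missing : (y : Maybe (Fin (suc m))) → sum (λ x → ⟦ ¬? (y ≟ᴹ just x) ⟧) ≡ missing y
sum-missing {m} nothing = trans (sum-const (suc m) 1) (*-identityʳ (suc m))
sum-missing {m} (just y) = suc-injective (begin
  1 + # ≢y                        ≡⟨ cong (_+ # ≢y) (#-≡ y) ⟨
  # (Finₚ._≟ y) + # ≢y            ≡⟨ cong (# (Finₚ._≟ y) +_) (sum-cong-≗ step) ⟩
  # (Finₚ._≟ y) + # (λ x → ¬? (x Finₚ.≟ y)) ≡⟨ #-∁ (Finₚ._≟ y) ⟩
  suc m                           ∎)
  where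
  open ≡-Reasoning
  ≢y : Decidable (λ x → just y ≢ just x)
  ≢y x = ¬? (just y ≟ᴹ just x)
  step : ∀ x → ⟦ ≢y x ⟧ ≡ ⟦ ¬? (x Finₚ.≟ y) ⟧
  step x with x Finₚ.≟ y
  ... | yes e = ⟦⟧-false (≢y x) (λ ne → ne (cong just (sym e)))
  ... | no ¬e = ⟦⟧-true (≢y x) (λ e → ¬e (sym (just-injective e)))

-- The method of conditional expectations: the values of χ are fixed one after
-- the other, never increasing the expected total weight of the missed targets.
derandomize : ∀ n (w : Fin p → ℕ) (t : Fin p → Target n (suc m)) →
  ∃ λ χ → suc m ^ n * sum (λ i → w i * ⟦ ¬? (hits? χ (t i)) ⟧) ≤ sum (λ i → w i * weight (t i))
derandomize zero w t = (λ ()) , ≤-reflexive (*-identityˡ _)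
derandomize {p} {m} (suc n) w t = χ , (begin
  suc m * suc m ^ n * sum (λ i → w i * ⟦ ¬? (hits? χ (t i)) ⟧)
    ≡⟨ *-assoc (suc m) (suc m ^ n) _ ⟩
  suc m * (suc m ^ n * sum (λ i → w i * ⟦ ¬? (hits? χ (t i)) ⟧))
    ≤⟨ *-monoʳ-≤ (suc m) (*-monoʳ-≤ (suc m ^ n) (sum-mono missed)) ⟩
  suc m * (suc m ^ n * sum (λ i → w′ x i * ⟦ ¬? (hits? χ′ (t i ∘ suc)) ⟧))
    ≤⟨ *-monoʳ-≤ (suc m) (proj₂ rest) ⟩
  suc m * sum (λ i → w′ x i * weight (t i ∘ suc))
    ≤⟨ proj₂ best ⟩
  sum (λ y → sum (λ i → w′ y i * weight (t i ∘ suc)))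
    ≡⟨ ∑-comm (λ y i → w′ y i * weight (t i ∘ suc)) ⟩
  sum (λ i → sum (λ y → w′ y i * weight (t i ∘ suc)))
    ≡⟨ sum-cong-≗ total ⟩
  sum (λ i → w i * weight (t i)) ∎)
  where
  open ≤-Reasoning
  w′ : Fin (suc m) → Fin p → ℕ
  w′ x i = w i * ⟦ ¬? (t i zero ≟ᴹ just x) ⟧
  best = average (λ x → sum (λ i → w′ x i * weight (t i ∘ suc)))
  x = proj₁ best
  rest = derandomize n (w′ x) (λ i → t i ∘ suc)
  χ′ = proj₁ rest
  χ : Fin (suc n) → Fin (suc m)
  χ zero    = x
  χ (suc v) = χ′ v
  missed : ∀ i → w i * ⟦ ¬? (hits? χ (t i)) ⟧ ≤ w′ x i * ⟦ ¬? (hits? χ′ (t i ∘ suc)) ⟧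
  missed i with t i zero ≟ᴹ just x | hits? χ′ (t i ∘ suc)
  ... | yes _ | _     = ≤-trans (≤-reflexive (*-zeroʳ (w i))) z≤n
  ... | no _  | yes _ = ≤-trans (≤-reflexive (*-zeroʳ (w i))) z≤n
  ... | no _  | no _  = ≤-reflexive (sym (*-identityʳ (w i * 1)))
  total : ∀ i → sum (λ y → w′ y i * weight (t i ∘ suc)) ≡ w i * weight (t i)
  total i = begin-equality
    sum (λ y → w′ y i * weight (t i ∘ suc))            ≡⟨ *-distribʳ-sum (weight (t i ∘ suc)) (λ y → w′ y i) ⟨
    sum (λ y → w′ y i) * weight (t i ∘ suc)            ≡⟨ cong (_* weight (t i ∘ suc)) (*-distribˡ-sum (w i) (λ y → ⟦ ¬? (t i zero ≟ᴹ just y) ⟧)) ⟨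
    w i * sum (λ y → ⟦ ¬? (t i zero ≟ᴹ just y) ⟧) * weight (t i ∘ suc) ≡⟨ cong (λ z → w i * z * weight (t i ∘ suc)) (sum-missing (t i zero)) ⟩
    w i * missing (t i zero) * weight (t i ∘ suc)      ≡⟨ *-assoc (w i) _ _ ⟩
    w i * weight (t i)                                 ∎

aim : {P : Fin n → Set} → Decidable P → (Fin n → Fin m) → Target n m
aim P? x v = if does (P? v) then just (x v) else nothing

aim-hit : {P : Fin n → Set} (P? : Decidable P) (x : Fin n → Fin m) {v : Fin n} {c : Fin m} →
          aim P? x v ≡ just c → P v × x v ≡ c
aim-hit P? x {v} e with P? v
... | yes p = p , just-injective e
aim-hit P? x {v} () | no _

weight-aim : {P : Fin n → Set} (P? : Decidable P) (x : Fin n → Fin (suc m)) →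
             weight (aim P? x) ≡ m ^ # P? * suc m ^ # (¬? ∘ P?)
weight-aim {zero}  P? x = refl
weight-aim {suc n} {m} P? x with P? zero
... | yes _ = trans (cong (m *_) (weight-aim (P? ∘ suc) (x ∘ suc))) (sym (*-assoc m _ _))
... | no  _ = trans (cong (suc m *_) (weight-aim (P? ∘ suc) (x ∘ suc))) (lemma (suc m) (m ^ # (P? ∘ suc)) (suc m ^ # (¬? ∘ P? ∘ suc)))
  where
  lemma : ∀ a b c → a * (b * c) ≡ b * (a * c)
  lemma = solve-∀

-- A random `χ` avoids one `h i` on all of `A` with probability `(m / suc m) ^ # A?`. By the
-- hypothesis the expected number of avoided functions is below 1, so the derandomized `χ` avoids
-- none.
cover : {A : Fin n → Set} (A? : Decidable A) (h : Fin p → Fin n → Fin (suc m)) →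
        p * m ^ # A? < suc m ^ # A? → ∃ λ χ → ∀ i → ∃ λ v → A v × h i v ≡ χ v
cover {n} {p} {m} {A} A? h small = χ , hit
  where
  open ≤-Reasoning
  t : Fin p → Target n (suc m)
  t i = aim A? (h i)
  dr = derandomize n (λ _ → 1) t
  χ = proj₁ dr
  missed = sum (λ i → 1 * ⟦ ¬? (hits? χ (t i)) ⟧)
  bound : suc m ^ n * missed < suc m ^ n * 1
  bound = begin-strict
    suc m ^ n * missed                           ≤⟨ proj₂ dr ⟩
    sum (λ i → 1 * weight (t i))                 ≡⟨ sum-cong-≗ (λ i → trans (*-identityˡ _) (weight-aim A? (h i))) ⟩
    sum {p} (λ _ → m ^ # A? * suc m ^ # (¬? ∘ A?)) ≡⟨ sum-const p _ ⟩
    p * (m ^ # A? * suc m ^ # (¬? ∘ A?))         ≡⟨ *-assoc p _ _ ⟨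
    p * m ^ # A? * suc m ^ # (¬? ∘ A?)           <⟨ *-monoˡ-< (suc m ^ # (¬? ∘ A?)) {{m^n≢0 (suc m) (# (¬? ∘ A?))}} small ⟩
    suc m ^ # A? * suc m ^ # (¬? ∘ A?)           ≡⟨ ^-distribˡ-+-* (suc m) (# A?) _ ⟨
    suc m ^ (# A? + # (¬? ∘ A?))                 ≡⟨ cong (suc m ^_) (#-∁ A?) ⟩
    suc m ^ n                                    ≡⟨ *-identityʳ _ ⟨
    suc m ^ n * 1                                ∎
  missed<1 : missed < 1
  missed<1 = *-cancelˡ-< (suc m ^ n) missed 1 bound
  hit : ∀ i → ∃ λ v → A v × h i v ≡ χ v
  hit i with hits? χ (t i) in eq
  ... | yes (v , e) = v , aim-hit A? (h i) e
  ... | no ¬h = contradiction (≤-trans (s≤s (≤-trans (≤-reflexive (sym (trans (*-identityˡ _) (⟦⟧-true (¬? (hits? χ (t i))) ¬h)))) (term≤sum (λ i → 1 * ⟦ ¬? (hits? χ (t i)) ⟧) i))) missed<1) (λ { (s≤s ()) })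

-- Exponential estimates

-- Bernoulli's inequality `(1 + 1/m) ^ c ≥ 1 + c/m` with the denominators cleared, which makes sense
-- for `m = 0` too.
bernoulli : ∀ m c → m ^ c * (m + c) ≤ suc m ^ c * m
bernoulli m zero = ≤-reflexive (cong (1 *_) (+-identityʳ m))
bernoulli m (suc c) = begin
  m * m ^ c * (m + suc c)        ≡⟨ lemma₁ m (m ^ c) c ⟩
  m ^ c * (m * (m + suc c))      ≤⟨ *-monoʳ-≤ (m ^ c) (m≤m+n _ c) ⟩
  m ^ c * (m * (m + suc c) + c)  ≡⟨ lemma₂ m (m ^ c) c ⟩
  suc m * (m ^ c * (m + c))      ≤⟨ *-monoʳ-≤ (suc m) (bernoulli m c) ⟩
  suc m * (suc m ^ c * m)        ≡⟨ *-assoc (suc m) (suc m ^ c) m ⟨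
  suc m * suc m ^ c * m          ∎
  where
  open ≤-Reasoning
  lemma₁ : ∀ m p c → m * p * (m + suc c) ≡ p * (m * (m + suc c))
  lemma₁ = solve-∀
  lemma₂ : ∀ m p c → p * (m * (m + suc c) + c) ≡ suc m * (p * (m + c))
  lemma₂ = solve-∀

-- With the exponent `c = k * suc m`, Bernoulli gives `(1 + 1/m) ^ c ≥ c/m ≥ k`. The case `m = 0` is
-- split off because `m` is cancelled at the end.
exponential-gap : ∀ k m → k * m ^ (k * suc m) ≤ suc m ^ (k * suc m)
exponential-gap zero    zero    = z≤n
exponential-gap (suc k) zero    = ≤-trans (≤-reflexive (*-zeroʳ (suc k))) z≤n
exponential-gap k m@(suc _) = *-cancelʳ-≤ _ _ m (begin
  k * m ^ c * m      ≡⟨ lemma k (m ^ c) m ⟩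
  m ^ c * (k * m)    ≤⟨ *-monoʳ-≤ (m ^ c) (≤-trans (*-monoʳ-≤ k (n≤1+n m)) (m≤n+m c m)) ⟩
  m ^ c * (m + c)    ≤⟨ bernoulli m c ⟩
  suc m ^ c * m      ∎)
  where
  open ≤-Reasoning
  c = k * suc m
  lemma : ∀ a b c → a * b * c ≡ b * (a * c)
  lemma = solve-∀

-- Each of the `b` factors `k` is paid for by `k * suc m` of the `a` factors `suc m / m`; at least
-- one such factor is left over and makes the inequality strict.
gap-power : ∀ k m b a → k * suc m * b < a → k ^ b * m ^ a < suc m ^ a
gap-power k m b a cb<a with m≤n⇒∃[o]m+o≡n cb<a
... | e , refl = begin-strict
  k ^ b * m ^ (suc (c * b) + e)        ≡⟨ cong (k ^ b *_) (cong (m ^_) (sym (+-suc (c * b) e))) ⟩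
  k ^ b * m ^ (c * b + suc e)          ≡⟨ cong (k ^ b *_) (^-distribˡ-+-* m (c * b) (suc e)) ⟩
  k ^ b * (m ^ (c * b) * m ^ suc e)    ≡⟨ *-assoc (k ^ b) _ _ ⟨
  k ^ b * m ^ (c * b) * m ^ suc e      ≡⟨ cong (λ z → k ^ b * z * m ^ suc e) (^-*-assoc m c b) ⟨
  k ^ b * (m ^ c) ^ b * m ^ suc e      ≡⟨ cong (_* m ^ suc e) (^-distribʳ-* b k (m ^ c)) ⟨
  (k * m ^ c) ^ b * m ^ suc e          ≤⟨ *-monoˡ-≤ (m ^ suc e) (^-monoˡ-≤ b (exponential-gap k m)) ⟩
  (suc m ^ c) ^ b * m ^ suc e          <⟨ *-monoʳ-< ((suc m ^ c) ^ b) {{m^n≢0 (suc m ^ c) b {{m^n≢0 (suc m) c}}}} (^-monoˡ-< (suc e) (n<1+n m)) ⟩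
  (suc m ^ c) ^ b * suc m ^ suc e      ≡⟨ cong (_* suc m ^ suc e) (^-*-assoc (suc m) c b) ⟩
  suc m ^ (c * b) * suc m ^ suc e      ≡⟨ ^-distribˡ-+-* (suc m) (c * b) (suc e) ⟨
  suc m ^ (c * b + suc e)              ≡⟨ cong (suc m ^_) (+-suc (c * b) e) ⟩
  suc m ^ (suc (c * b) + e)            ∎
  where
  open ≤-Reasoning
  c = k * suc m
  ^-distribʳ-* : ∀ n a b → (a * b) ^ n ≡ a ^ n * b ^ n
  ^-distribʳ-* zero a b = refl
  ^-distribʳ-* (suc n) a b = trans (cong (a * b *_) (^-distribʳ-* n a b)) (lemma a b (a ^ n) (b ^ n))
    where
    lemma : ∀ a b c d → a * b * (c * d) ≡ a * c * (b * d)
    lemma = solve-∀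

-- One assignment against all colourings of a small set

-- Functions are listed only up to agreement on `B`, so that the number of entries is exponential in
-- `# B?` and not in `n`.
enumerate : ∀ {B : Fin n → Set} (B? : Decidable B) k →
  ∃ λ (f : Fin (suc k ^ # B?) → Fin n → Fin (suc k)) →
  ∀ (g : Fin n → Fin (suc k)) → ∃ λ i → ∀ v → B v → f i v ≡ g v
enumerate {zero}  B? k = (λ _ ()) , λ g → zero , λ ()
enumerate {suc n} {B} B? k with B? zero | enumerate (B? ∘ suc) k
... | yes _ | f , f-enum = f′ , λ g → combine (g zero) (proj₁ (f-enum (g ∘ suc))) , agrees g
  where
  q = suc k ^ # (B? ∘ suc)
  f′ : Fin (suc k * q) → Fin (suc n) → Fin (suc k)
  f′ i zero    = proj₁ (remQuot {suc k} q i)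
  f′ i (suc v) = f (proj₂ (remQuot {suc k} q i)) v
  agrees : ∀ g v → B v → f′ (combine (g zero) (proj₁ (f-enum (g ∘ suc)))) v ≡ g v
  agrees g zero    _ = cong proj₁ (remQuot-combine (g zero) (proj₁ (f-enum (g ∘ suc))))
  agrees g (suc v) b = trans (cong (λ x → f (proj₂ x) v) (remQuot-combine (g zero) (proj₁ (f-enum (g ∘ suc)))))
                             (proj₂ (f-enum (g ∘ suc)) v b)
... | no ¬b₀ | f , f-enum = f′ , λ g → proj₁ (f-enum (g ∘ suc)) , agrees g
  where
  f′ : Fin (suc k ^ # (B? ∘ suc)) → Fin (suc n) → Fin (suc k)
  f′ i zero    = zero
  f′ i (suc v) = f i v
  agrees : ∀ g v → B v → f′ (proj₁ (f-enum (g ∘ suc))) v ≡ g v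
  agrees g zero    b = contradiction b ¬b₀
  agrees g (suc v) b = proj₂ (f-enum (g ∘ suc)) v b

abstract
  -- Here `h f a` is the answer at `a` that defeats the colouring `f`. As `A` is much larger than
  -- `B`, `cover` applies to the answers to all listed colourings of `B`, and one `χ` gives the
  -- right answer to each of them somewhere in `A`. The conclusion is about a listed `f` that agrees
  -- with `g` on `B`, since `h` may look at values elsewhere.
  kill : ∀ k {A B : Fin n → Set} (A? : Decidable A) (B? : Decidable B)
    (h : (Fin n → Fin (suc k)) → Fin n → Fin (suc m)) → suc k * suc m * # B? < # A? →
    ∃ λ (χ : Fin n → Fin (suc m)) → ∀ (g : Fin n → Fin (suc k)) → ∃ λ (f : Fin n → Fin (suc k)) → (∀ v → B v → f v ≡ g v) × ∃ λ a → A a × h f a ≡ χ a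
  kill {n} {m} k A? B? h large with enumerate B? k
  ... | f , f-enum with cover A? (λ i → h (f i)) (gap-power (suc k) m (# B?) (# A?) large)
  ... | χ , χ-hits = χ , λ g → f (proj₁ (f-enum g)) , proj₂ (f-enum g) , χ-hits (proj₁ (f-enum g))

-- Large independent sets in relations of bounded degree

record Independent {n} {A : Fin n → Set} (A? : Decidable A) (R : Fin n → Fin n → Set) (c : ℕ) : Set₁ where
  field
    I       : Fin n → Set
    I?      : Decidable I
    I⊆A     : ∀ {a} → I a → A a
    apart   : ∀ {a b} → I a → I b → R a b → R b a → a ≡ b
    I-large : # A? ≤ # I? * c

abstract
  -- Greedily: keep some `a` in `A`, discard the at most `c` elements it is related to, and continue
  -- with the rest. Reflexivity discards `a` itself, so the set shrinks and `a` is not counted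
  -- twice.
  independent : ∀ {A : Fin n → Set} (A? : Decidable A) {R : Fin n → Fin n → Set} (R? : ∀ a → Decidable (R a)) c →
    (∀ a → A a → R a a) → (∀ a → A a → # (R? a) ≤ c) → Independent A? R c
  independent {n} A? {R} R? c = go (# A?) A? ≤-refl
    where
    go : ∀ N {A : Fin n → Set} (A? : Decidable A) → # A? ≤ N →
         (∀ a → A a → R a a) → (∀ a → A a → # (R? a) ≤ c) → Independent A? R c
    go N {A} A? A≤N R-refl R≤c with any? A?
    ... | no ∄A = record
      { I = A ; I? = A? ; I⊆A = id ; apart = λ {a} Aa → contradiction (a , Aa) ∄A
      ; I-large = ≤-trans (≮⇒≥ (λ 1≤ → ∄A (1≤#⇒∃ A? 1≤))) z≤n }
    go zero A? A≤N R-refl R≤c | yes ∃A = contradiction (≤-trans (∃⇒1≤# A? ∃A) A≤N) λ ()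
    go (suc N) {A} A? A≤N R-refl R≤c | yes (a , Aa) = record
      { I = I⁺ ; I? = I⁺? ; I⊆A = I⁺⊆A ; apart = I⁺-apart ; I-large = I⁺-large }
      where
      A′? : Decidable (λ b → A b × ¬ R a b)
      A′? b = A? b ×-dec ¬? (R? a b)
      A′<A : suc (# A′?) ≤ # A?
      A′<A = ≤-trans (≤-reflexive (cong (_+ # A′?) (sym (#-≡ a))))
        (#-⊎ A? (Finₚ._≟ a) A′? (λ { b refl → Aa }) (λ _ → proj₁) (λ { b refl (_ , ¬R) → ¬R (R-refl b Aa) }))
      open Independent (go N A′? (s≤s⁻¹ (≤-trans A′<A A≤N)) (λ b → R-refl b ∘ proj₁) (λ b → R≤c b ∘ proj₁))
      I⁺ : Fin n → Set
      I⁺ b = b ≡ a ⊎ I b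
      I⁺? : Decidable I⁺
      I⁺? b = (b Finₚ.≟ a) ⊎-dec I? b
      I⁺⊆A : ∀ {b} → I⁺ b → A b
      I⁺⊆A (inj₁ refl) = Aa
      I⁺⊆A (inj₂ i)    = proj₁ (I⊆A i)
      I⁺-apart : ∀ {b b′} → I⁺ b → I⁺ b′ → R b b′ → R b′ b → b ≡ b′
      I⁺-apart (inj₁ refl) (inj₁ refl) _ _ = refl
      I⁺-apart (inj₁ refl) (inj₂ i) r _    = contradiction r (proj₂ (I⊆A i))
      I⁺-apart (inj₂ i) (inj₁ refl) _ r    = contradiction r (proj₂ (I⊆A i))
      I⁺-apart (inj₂ i) (inj₂ j) r r′      = apart i j r r′
      I<I⁺ : suc (# I?) ≤ # I⁺?
      I<I⁺ = ≤-trans (≤-reflexive (cong (_+ # I?) (sym (#-≡ a))))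
        (#-⊎ I⁺? (Finₚ._≟ a) I? (λ _ → inj₁) (λ _ → inj₂) (λ { b refl i → proj₂ (I⊆A i) (R-refl b Aa) }))
      split : ∀ b → A b → R a b ⊎ (A b × ¬ R a b)
      split b Ab with R? a b
      ... | yes r = inj₁ r
      ... | no ¬r = inj₂ (Ab , ¬r)
      open ≤-Reasoning
      I⁺-large : # A? ≤ # I⁺? * c
      I⁺-large = begin
        # A?                  ≤⟨ #-∪ A? (R? a) A′? split ⟩
        # (R? a) + # A′?      ≤⟨ +-mono-≤ (R≤c a Aa) I-large ⟩
        suc (# I?) * c        ≤⟨ *-monoˡ-≤ c I<I⁺ ⟩
        # I⁺? * c             ∎

-- The pigeonhole principle with multiplicities

choose : {P : Fin n → Set} (P? : Decidable P) → m ≤ # P? →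
         ∃ λ (e : Fin m → Fin n) → Injective _≡_ _≡_ e × ∀ q → P (e q)
choose {n} {zero} P? _ = (λ ()) , (λ {}) , λ ()
choose {suc n} {suc m} P? m<# with P? zero
... | yes p₀ with choose (P? ∘ suc) (s≤s⁻¹ m<#)
...   | e , e-inj , Pe = e′ , e′-inj , Pe′
  where
  e′ : Fin (suc m) → Fin (suc n)
  e′ zero    = zero
  e′ (suc q) = suc (e q)
  e′-inj : Injective _≡_ _≡_ e′
  e′-inj {zero}  {zero}  _  = refl
  e′-inj {suc _} {suc _} eq = cong suc (e-inj (Finₚ.suc-injective eq))
  Pe′ : ∀ q → _
  Pe′ zero    = p₀
  Pe′ (suc q) = Pe q
choose {suc n} {suc m} P? m<# | no _ with choose (P? ∘ suc) m<#
... | e , e-inj , Pe = suc ∘ e , (λ eq → e-inj (Finₚ.suc-injective eq)) , Pe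

abstract
  frequent : (f : Fin (suc (m * k)) → Fin m) → ∃ λ x → ∃ λ (e : Fin (suc k) → Fin (suc (m * k))) →
             Injective _≡_ _≡_ e × ∀ q → f (e q) ≡ x
  frequent {m} {k} f with any? (λ x → suc k ≤? # (λ i → f i Finₚ.≟ x))
  ... | yes (x , k<#) = x , choose (λ i → f i Finₚ.≟ x) k<#
  ... | no ¬large = contradiction (begin-strict
    m * k                                  <⟨ n<1+n (m * k) ⟩
    suc (m * k)                            ≡⟨ #-all (λ _ → yes tt) (λ _ → tt) ⟨
    # {suc (m * k)} (λ _ → yes tt)         ≡⟨ #-fibres (λ _ → yes tt) f ⟨
    sum (λ x → # (λ i → yes tt ×-dec (f i Finₚ.≟ x))) ≤⟨ sum-mono (λ x → #-mono (λ i → yes tt ×-dec (f i Finₚ.≟ x)) (λ i → f i Finₚ.≟ x) (λ _ → proj₂)) ⟩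
    sum (λ x → # (λ i → f i Finₚ.≟ x))     ≤⟨ sum-mono (λ x → s≤s⁻¹ (≰⇒> (λ k<# → ¬large (x , k<#)))) ⟩
    sum {m} (λ _ → k)                      ≡⟨ sum-const m k ⟩
    m * k                                  ∎) (<-irrefl refl)
    where open ≤-Reasoning

-- Many vertices that see all classes of a small coloured set

Coloured : Target n m → Fin n → Set
Coloured κ v = ∃ λ c → κ v ≡ just c

coloured? : (κ : Target n m) → Decidable (Coloured κ)
coloured? κ v = any? (λ c → κ v ≟ᴹ just c)

uncoloured : (κ : Target n m) (v : Fin n) → ¬ Coloured κ v → κ v ≡ nothing
uncoloured κ v ¬col with κ v
... | nothing = refl
... | just c  = contradiction (c , refl) ¬col

-- The vertices coloured by `κ` form the small set `B` of the idea, and `A′` is the large set: each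
-- of its vertices has an `S`-neighbour in every one of the `s` classes. `plain` keeps the two sets
-- disjoint, and `large` is the surplus that `kill` consumes.
record Rainbow (C : ℕ) {n s : ℕ} (U A : Fin n → Set) (S : Fin n → Fin n → Set) : Set₁ where
  field
    κ     : Target n s
    A′    : Fin n → Set
    A′?   : Decidable A′
    A′⊆A  : ∀ {a} → A′ a → A a
    plain : ∀ {a} → A′ a → κ a ≡ nothing
    sees  : ∀ {a} → A′ a → ∀ c → ∃ λ u → S a u × κ u ≡ just c
    κ⊆U   : ∀ {u c} → κ u ≡ just c → U u
    large : C * # (coloured? κ) < # A′?

module _ {n m d} {A : Fin n → Set} {S : Fin n → Fin n → Set}
  (A? : Decidable A) (S? : ∀ a → Decidable (S a)) (gap : 2 * suc m * m ^ d ≤ suc m ^ d)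
  (S-large : ∀ a → A a → d ≤ # (S? a)) where

  private
    M = suc m
    open ≤-Reasoning

    -- The probability that no vertex of `S a` gets colour `c` is at most `(m / M) ^ d`, cleared of
    -- denominators: in the exponent `d + e`, the last `e` factors `m` are estimated by `M`.
    weight-small : ∀ a (c : Fin M) → A a → weight (aim (S? a) (λ _ → c)) * M ^ d ≤ m ^ d * M ^ n
    weight-small a c Aa with m≤n⇒∃[o]m+o≡n (S-large a Aa)
    ... | e , d+e≡σ = begin
      weight (aim (S? a) (λ _ → c)) * M ^ d  ≡⟨ cong (_* M ^ d) (weight-aim (S? a) (λ _ → c)) ⟩
      m ^ σ * M ^ τ * M ^ d                ≡⟨ cong (λ z → m ^ z * M ^ τ * M ^ d) d+e≡σ ⟨
      m ^ (d + e) * M ^ τ * M ^ d     ≡⟨ cong (λ z → z * M ^ τ * M ^ d) (^-distribˡ-+-* m d e) ⟩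
      m ^ d * m ^ e * M ^ τ * M ^ d ≡⟨ lemma (m ^ d) (m ^ e) (M ^ τ) (M ^ d) ⟩
      m ^ e * (m ^ d * (M ^ d * M ^ τ)) ≤⟨ *-monoˡ-≤ (m ^ d * (M ^ d * M ^ τ)) (^-monoˡ-≤ e (n≤1+n m)) ⟩
      M ^ e * (m ^ d * (M ^ d * M ^ τ)) ≡⟨ lemma′ (M ^ e) (m ^ d) (M ^ d) (M ^ τ) ⟩
      m ^ d * (M ^ d * M ^ e * M ^ τ) ≡⟨ cong (λ z → m ^ d * (z * M ^ τ)) (^-distribˡ-+-* M d e) ⟨
      m ^ d * (M ^ (d + e) * M ^ τ)   ≡⟨ cong (m ^ d *_) (^-distribˡ-+-* M (d + e) τ) ⟨
      m ^ d * M ^ (d + e + τ)         ≡⟨ cong (λ z → m ^ d * M ^ (z + τ)) d+e≡σ ⟩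
      m ^ d * M ^ (σ + τ)                  ≡⟨ cong (λ z → m ^ d * M ^ z) (#-∁ (S? a)) ⟩
      m ^ d * M ^ n                        ∎
      where
      σ = # (S? a)
      τ = # (¬? ∘ S? a)
      lemma : ∀ a b c d → a * b * c * d ≡ b * (a * (d * c))
      lemma = solve-∀
      lemma′ : ∀ a b c d → a * (b * (c * d)) ≡ b * (c * a * d)
      lemma′ = solve-∀

    target : Fin (n * M) → Target n M
    target i = aim (S? (proj₁ (remQuot {n} M i))) (λ _ → proj₂ (remQuot {n} M i))

    w : Fin (n * M) → ℕ
    w i = ⟦ A? (proj₁ (remQuot {n} M i)) ⟧

    random = derandomize n w target
    χ = proj₁ random

    sum-pairs : (f : Fin n × Fin M → ℕ) → sum (λ i → f (remQuot {n} M i)) ≡ sum (λ a → sum (λ c → f (a , c)))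
    sum-pairs f = trans (sum-combine n (λ i → f (remQuot {n} M i)))
      (sum-cong-≗ (λ a → sum-cong-≗ (λ c → cong f (remQuot-combine a c))))

    misses? : ∀ a c → Dec (¬ Hits χ (aim (S? a) (λ _ → c)))
    misses? a c = ¬? (hits? χ (aim (S? a) (λ _ → c)))

    Bad : Fin n → Set
    Bad a = A a × ∃ λ c → ¬ Hits χ (aim (S? a) (λ _ → c))
    bad? : Decidable Bad
    bad? a = A? a ×-dec any? (misses? a)

    bad-bound : M ^ n * # bad? ≤ sum (λ a → sum (λ c → ⟦ A? a ⟧ * weight (aim (S? a) (λ _ → c))))
    bad-bound = begin
      M ^ n * # bad?                                           ≤⟨ *-monoʳ-≤ (M ^ n) (sum-mono step) ⟩
      M ^ n * sum (λ a → sum (λ c → ⟦ A? a ⟧ * ⟦ misses? a c ⟧)) ≡⟨ cong (M ^ n *_) (sum-pairs (λ (a , c) → ⟦ A? a ⟧ * ⟦ misses? a c ⟧)) ⟨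
      M ^ n * sum (λ i → w i * ⟦ ¬? (hits? χ (target i)) ⟧)    ≤⟨ proj₂ random ⟩
      sum (λ i → w i * weight (target i))                      ≡⟨ sum-pairs (λ (a , c) → ⟦ A? a ⟧ * weight (aim (S? a) (λ _ → c))) ⟩
      sum (λ a → sum (λ c → ⟦ A? a ⟧ * weight (aim (S? a) (λ _ → c)))) ∎
      where
      step : ∀ a → ⟦ bad? a ⟧ ≤ sum (λ c → ⟦ A? a ⟧ * ⟦ misses? a c ⟧)
      step a = ⟦⟧-≤ (bad? a) λ (Aa , c , miss) →
        ≤-trans (≤-reflexive (sym (cong₂ _*_ (⟦⟧-true (A? a) Aa) (⟦⟧-true (misses? a c) miss))))
                (term≤sum (λ c → ⟦ A? a ⟧ * ⟦ misses? a c ⟧) c)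

    -- A vertex of `A` misses some of the `M` colours with probability at most `M * (m / M) ^ d`,
    -- which is at most 1/2 by `gap`.
    bad≤A/2 : 2 * # bad? ≤ # A?
    bad≤A/2 = *-cancelˡ-≤ (M ^ d) {{m^n≢0 M d}} (*-cancelˡ-≤ (M ^ n) {{m^n≢0 M n}} (begin
      M ^ n * (M ^ d * (2 * # bad?))    ≡⟨ lemma₁ (M ^ n) (M ^ d) (# bad?) ⟩
      2 * M ^ d * (M ^ n * # bad?)      ≤⟨ *-monoʳ-≤ (2 * M ^ d) bad-bound ⟩
      2 * M ^ d * sum (λ a → sum (λ c → ⟦ A? a ⟧ * weight (aim (S? a) (λ _ → c))))
        ≡⟨ *-assoc 2 (M ^ d) _ ⟩
      2 * (M ^ d * sum (λ a → sum (λ c → ⟦ A? a ⟧ * weight (aim (S? a) (λ _ → c)))))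
        ≡⟨ cong (2 *_) (*-distribˡ-sum (M ^ d) (λ a → sum (λ c → ⟦ A? a ⟧ * weight (aim (S? a) (λ _ → c))))) ⟩
      2 * sum (λ a → M ^ d * sum (λ c → ⟦ A? a ⟧ * weight (aim (S? a) (λ _ → c))))
        ≤⟨ *-monoʳ-≤ 2 (sum-mono step) ⟩
      2 * sum (λ a → ⟦ A? a ⟧ * (M * (m ^ d * M ^ n)))
        ≡⟨ cong (2 *_) (*-distribʳ-sum (M * (m ^ d * M ^ n)) (λ a → ⟦ A? a ⟧)) ⟨
      2 * (# A? * (M * (m ^ d * M ^ n)))  ≡⟨ lemma₂ (# A?) M (m ^ d) (M ^ n) ⟩
      M ^ n * (2 * M * m ^ d * # A?)  ≤⟨ *-monoʳ-≤ (M ^ n) (*-monoˡ-≤ (# A?) (gap)) ⟩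
      M ^ n * (M ^ d * # A?)            ∎))
      where
      lemma₁ : ∀ a b c → a * (b * (2 * c)) ≡ 2 * b * (a * c)
      lemma₁ = solve-∀
      lemma₂ : ∀ a b c d → 2 * (a * (b * (c * d))) ≡ d * (2 * b * c * a)
      lemma₂ = solve-∀
      step : ∀ a → M ^ d * sum (λ c → ⟦ A? a ⟧ * weight (aim (S? a) (λ _ → c))) ≤ ⟦ A? a ⟧ * (M * (m ^ d * M ^ n))
      step a with A? a
      ... | no _   = ≤-reflexive (trans (cong (M ^ d *_) (trans (sum-const M 0) (*-zeroʳ M))) (*-zeroʳ (M ^ d)))
      ... | yes Aa = begin
        M ^ d * sum (λ c → 1 * weight (aim (S? a) (λ _ → c)))
          ≡⟨ *-distribˡ-sum (M ^ d) (λ c → 1 * weight (aim (S? a) (λ _ → c))) ⟩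
        sum (λ c → M ^ d * (1 * weight (aim (S? a) (λ _ → c))))
          ≤⟨ sum-mono (λ c → ≤-trans (≤-reflexive (trans (cong (M ^ d *_) (*-identityˡ _)) (*-comm (M ^ d) (weight (aim (S? a) (λ _ → c)))))) (weight-small a c Aa)) ⟩
        sum {M} (λ _ → m ^ d * M ^ n)  ≡⟨ sum-const M _ ⟩
        M * (m ^ d * M ^ n)            ≡⟨ *-identityˡ _ ⟨
        1 * (M * (m ^ d * M ^ n))      ∎

  half-rainbow : ∃ λ χ → 2 * # (λ a → A? a ×-dec any? (λ c → ¬? (hits? χ (aim (S? a) (λ _ → c))))) ≤ # A?
  half-rainbow = χ , bad≤A/2

-- A random colouring with g blocks of suc s colours each is seen completely by
-- half of A, and restricting it to the smallest block gives κ.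
module Split (s q C : ℕ) where

  -- The `suc g-1` blocks of `suc s` colours make `suc m-1` colours, an identity that holds by
  -- computation. The number of blocks is such that the smallest one contains at most
  -- `# A? / (2 * C + 3)` vertices of `U`.
  g-1 m-1 : ℕ
  g-1 = q * (2 * C + 3)
  m-1 = s + g-1 * suc s

  -- The exponent for which `exponential-gap` gains the factor `2 * suc m-1`: a union bound over all
  -- colours, with error 1/2.
  degree : ℕ
  degree = 2 * suc m-1 * suc m-1

  module _ {n} {U A : Fin n → Set} {S : Fin n → Fin n → Set}
    (U? : Decidable U) (A? : Decidable A) (S? : ∀ a → Decidable (S a))
    (A-inhabited : 1 ≤ # A?) (U≤qA : # U? ≤ q * # A?)
    (S-large : ∀ a → A a → degree ≤ # (S? a)) (S⊆U : ∀ a u → A a → S a u → U u) where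

    private
      open ≤-Reasoning

      random = half-rainbow {m = m-1} A? S? (exponential-gap (2 * suc m-1) m-1) S-large
      χ = proj₁ random
      Bad : Fin n → Set
      Bad a = A a × ∃ λ c → ¬ Hits χ (aim (S? a) (λ _ → c))
      bad? : Decidable Bad
      bad? a = A? a ×-dec any? (λ c → ¬? (hits? χ (aim (S? a) (λ _ → c))))

      block : Fin n → Fin (suc g-1)
      block v = proj₁ (remQuot {suc g-1} (suc s) (χ v))
      smallest = average (λ y → # (λ v → U? v ×-dec (block v Finₚ.≟ y)))
      y = proj₁ smallest
      V? : Decidable (λ v → U v × block v ≡ y)
      V? v = U? v ×-dec (block v Finₚ.≟ y)

      colour : Target n (suc s)
      colour = aim V? (λ v → proj₂ (remQuot {suc g-1} (suc s) (χ v)))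

      Good : Fin n → Set
      Good a = A a × colour a ≡ nothing × ∀ c → ∃ λ u → S a u × colour u ≡ just c
      good? : Decidable Good
      good? a = A? a ×-dec ((colour a ≟ᴹ nothing) ×-dec all? (λ c → any? (λ u → S? a u ×-dec (colour u ≟ᴹ just c))))

      coloured⊆V : ∀ {v c} → colour v ≡ just c → U v × block v ≡ y
      coloured⊆V e = proj₁ (aim-hit V? (λ v → proj₂ (remQuot {suc g-1} (suc s) (χ v))) e)

      A⊆ : ∀ a → A a → Good a ⊎ (Bad a ⊎ Coloured colour a)
      A⊆ a Aa with coloured? colour a | bad? a
      ... | yes col | _     = inj₂ (inj₂ col)
      ... | no _    | yes b = inj₂ (inj₁ b)
      ... | no ¬col | no ¬b = inj₁ (Aa , uncoloured colour a ¬col , sees)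
        where
        sees : ∀ c → ∃ λ u → S a u × colour u ≡ just c
        -- The wish is for the full colour `combine y c`: a vertex that fulfils it lies in block `y`
        -- and keeps the colour `c` after the restriction.
        sees c with hits? χ (aim (S? a) (λ _ → combine y c))
        ... | no miss = contradiction (Aa , combine y c , miss) ¬b
        ... | yes (u , e) = u , Sau , colour-u
          where
          Sau = proj₁ (aim-hit (S? a) _ e)
          pair : remQuot {suc g-1} (suc s) (χ u) ≡ (y , c)
          pair = trans (cong (remQuot {suc g-1} (suc s)) (sym (proj₂ (aim-hit (S? a) _ e)))) (remQuot-combine y c)
          colour-u : colour u ≡ just c
          colour-u = trans (cong (if_then just (proj₂ (remQuot {suc g-1} (suc s) (χ u))) else nothing)
                             (dec-true (V? u) (S⊆U a u Aa Sau , cong proj₁ pair)))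
                           (cong (just ∘ proj₂) pair)

      -- Here `u` counts the smallest block, `b` the coloured vertices, and `a`, `a′`, `d` the
      -- vertices of `A`, the good and the bad ones. The block size gives `(2 * C + 3) * b ≤ a`, and
      -- discarding bad and coloured vertices gives `a ≤ 2 * a′ + 2 * b`. Strictness comes from the
      -- 3 if `b > 0`, and from `1 ≤ a` if `b = 0`.
      arithmetic : ∀ b u a a′ d → b ≤ u → 1 ≤ a → suc g-1 * u ≤ q * a → 2 * d ≤ a → a ≤ a′ + (d + b) → C * b < a′
      arithmetic b u a a′ d b≤u 1≤a gu≤qa 2d≤a a≤ = *-cancelˡ-< 2 (C * b) a′ (+-cancelʳ-< (2 * b) (2 * (C * b)) (2 * a′) (begin-strict
        2 * (C * b) + 2 * b  <⟨ few b (small q (≤-trans (*-monoʳ-≤ (suc g-1) b≤u) gu≤qa)) ⟩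
        a                    ≤⟨ +-cancelʳ-≤ a a (2 * a′ + 2 * b) (begin
          a + a                     ≡⟨ lemma₃ a ⟩
          2 * a                     ≤⟨ *-monoʳ-≤ 2 a≤ ⟩
          2 * (a′ + (d + b))        ≡⟨ lemma₄ a′ d b ⟩
          2 * a′ + 2 * b + 2 * d    ≤⟨ +-monoʳ-≤ (2 * a′ + 2 * b) 2d≤a ⟩
          2 * a′ + 2 * b + a        ∎) ⟩
        2 * a′ + 2 * b       ∎))
        where
        lemma₃ : ∀ a → a + a ≡ 2 * a
        lemma₃ = solve-∀
        lemma₄ : ∀ a′ d b → 2 * (a′ + (d + b)) ≡ 2 * a′ + 2 * b + 2 * d
        lemma₄ = solve-∀
        lemma₅ : ∀ q x b → b + q * x * b ≡ q * (x * b) + b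
        lemma₅ = solve-∀
        lemma₆ : ∀ C b → suc (2 * (C * suc b) + 2 * suc b) + b ≡ (2 * C + 3) * suc b
        lemma₆ = solve-∀
        small : ∀ q → suc (q * (2 * C + 3)) * b ≤ q * a → (2 * C + 3) * b ≤ a
        small zero    h = ≤-trans (≤-reflexive (trans (cong ((2 * C + 3) *_) (n≤0⇒n≡0 (m+n≤o⇒m≤o b h))) (*-zeroʳ (2 * C + 3)))) z≤n
        small (suc q′) h = *-cancelˡ-≤ (suc q′) (m+n≤o⇒m≤o (suc q′ * ((2 * C + 3) * b)) (≤-trans (≤-reflexive (sym (lemma₅ (suc q′) (2 * C + 3) b))) h))
        few : ∀ b → (2 * C + 3) * b ≤ a → 2 * (C * b) + 2 * b < a
        few zero    _ = ≤-trans (s≤s (≤-reflexive (cong (λ z → 2 * z + 0) (*-zeroʳ C)))) 1≤a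
        few (suc b) h = ≤-trans (m≤m+n _ b) (≤-trans (≤-reflexive (lemma₆ C b)) h)

    rainbow : Rainbow C {s = suc s} U A S
    rainbow = record
      { κ = colour ; A′ = Good ; A′? = good?
      ; A′⊆A = proj₁ ; plain = proj₁ ∘ proj₂ ; sees = proj₂ ∘ proj₂
      ; κ⊆U = proj₁ ∘ coloured⊆V
      ; large = arithmetic (# (coloured? colour)) (# V?) (# A?) (# good?) (# bad?)
          (#-mono (coloured? colour) V? (λ v (_ , e) → coloured⊆V e)) A-inhabited
          (≤-trans (proj₂ smallest) (≤-trans (≤-reflexive (#-fibres U? block)) U≤qA)) (proj₂ random)
          (≤-trans (#-∪ A? good? bc? A⊆) (+-monoʳ-≤ (# good?) (#-∪ bc? bad? (coloured? colour) (λ _ → id))))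
      }
      where
      bc? : Decidable (λ a → Bad a ⊎ Coloured colour a)
      bc? a = bad? a ⊎-dec coloured? colour a

abstract
  rainbow-degree : ℕ → ℕ → ℕ → ℕ
  rainbow-degree = Split.degree

  rainbow : ∀ s q C {n} {U A : Fin n → Set} {S : Fin n → Fin n → Set}
    (U? : Decidable U) (A? : Decidable A) (S? : ∀ a → Decidable (S a)) → 1 ≤ # A? → # U? ≤ q * # A? →
    (∀ a → A a → rainbow-degree s q C ≤ # (S? a)) → (∀ a u → A a → S a u → U u) → Rainbow C {s = suc s} U A S
  rainbow = Split.rainbow

-- Lists without good colourings

card≡# : (p : Fin m → Bool) → card p ≡ # (λ v → p v Boolₚ.≟ true)
card≡# {zero}  p = refl
card≡# {suc m} p with p zero
... | true  = cong suc (card≡# (p ∘ suc))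
... | false = card≡# (p ∘ suc)

enumeration : (Fin k → ℕ) → List ℕ
enumeration {k} f = map f (allFin k)

∈-enumeration : (f : Fin k → ℕ) {x : ℕ} → x ∈ enumeration f → ∃ λ i → x ≡ f i
∈-enumeration f x∈ = let i , _ , e = ∈-map⁻ f x∈ in i , e

enumeration-list : (f : Fin k → ℕ) → Injective _≡_ _≡_ f → Unique (enumeration f) × length (enumeration f) ≡ k
enumeration-list {k} f f-inj = map⁺ f-inj (allFin⁺ k) , trans (length-map f (allFin k)) (length-tabulate id)

-- Colour class j of B gets the j-th of K disjoint lists, and each vertex of A
-- gets a transversal of these lists.
module Palette (k : ℕ) where

  -- There are `K` groups of `copies` classes, and all classes of a group share a list of `K`
  -- colours. As `copies` exceeds `K * K`, some colour is repeated at the representatives of `suc K`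
  -- classes of the group, one more than the length of a list. `ratio` is the factor that `kill`
  -- requires for `suc transversals` answers.
  K copies classes-1 classes transversals ratio : ℕ
  K = suc k
  copies = suc (K * K)
  classes-1 = K * K + k * copies
  classes = K * copies
  transversals = K ^ K
  ratio = K * suc transversals

  private
    colour : Fin K → Fin K → ℕ
    colour j x = toℕ (combine j x)

    colour-injective : ∀ {i j x y} → colour i x ≡ colour j y → i ≡ j × x ≡ y
    colour-injective {i} {j} {x} {y} e = Finₚ.combine-injective i x j y (toℕ-injective e)

    -- Codes are shifted by one so that their type is visibly nonempty, as `kill` requires; code
    -- zero decodes to an arbitrary transversal.
    encode : (Fin K → Fin K) → Fin (suc transversals)
    encode f = suc (funToFin f)

    decode : Fin (suc transversals) → Fin K → Fin K
    decode zero    = λ _ → zero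
    decode (suc i) = finToFun i

    group : Fin classes → Fin K
    group c = proj₁ (remQuot {K} copies c)

  module _ (κ : Target n classes) {A : Fin n → Set} (A? : Decidable A) (β : Fin n → Fin classes → Fin n)
    (plain : ∀ {a} → A a → κ a ≡ nothing) (β-colour : ∀ {a} → A a → ∀ c → κ (β a c) ≡ just c)
    (large : ratio * # (coloured? κ) < # A?) where

    private
      -- In each group `j`, a colour index that `g` gives to `suc K` representatives of `a`. A list
      -- of `a` made of these colours contains none that differs from all representatives.
      majority : (Fin n → Fin K) → Fin n → Fin K → Fin K
      majority g a j = proj₁ (frequent {K} {K} (λ i → g (β a (combine j i))))

      killing = kill {m = transversals} k A? (coloured? κ) (λ g a → encode (majority g a)) large
      τ = proj₁ killing

      -- Vertices outside `A` and the coloured set get the list of group zero, which consists of the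
      -- numbers below `K`.
      palette : Maybe (Fin classes) → {P : Set} → Dec P → Fin n → Fin K → ℕ
      palette (just c) _       v = colour (group c)
      palette nothing  (yes _) v = λ j → colour j (decode (τ v) j)
      palette nothing  (no _)  v = colour zero

      palette-injective : ∀ x {P : Set} (P? : Dec P) v → Injective _≡_ _≡_ (palette x P? v)
      palette-injective (just c) _       v e = proj₂ (colour-injective {group c} {group c} e)
      palette-injective nothing  (yes _) v {i} {j} e = proj₁ (colour-injective {i} {j} e)
      palette-injective nothing  (no _)  v e = proj₂ (colour-injective {zero} {zero} e)

      palette-default : ∀ {x} {P : Set} (P? : Dec P) v i → x ≡ nothing → ¬ P → palette x P? v i < K
      palette-default (yes p) v i refl ¬p = contradiction p ¬p
      palette-default (no _)  v i refl _  = ≤-trans (s≤s (≤-reflexive (Finₚ.toℕ-↑ˡ i (k * K)))) (Finₚ.toℕ<n i)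

      palette-transversal : ∀ {x} {P : Set} (P? : Dec P) v j → x ≡ nothing → P →
                            palette x P? v j ≡ colour j (decode (τ v) j)
      palette-transversal (yes _) v j refl _ = refl
      palette-transversal (no ¬p) v j refl p = contradiction p ¬p

      palette-group : ∀ x {P : Set} (P? : Dec P) v i → ∃ λ i′ → ∀ d → x ≡ just d → palette x P? v i ≡ colour (group d) i′
      palette-group (just d) P? v i = i , λ { .d refl → refl }
      palette-group nothing  P? v i = zero , λ _ ()

    L : Fin n → List ℕ
    L v = enumeration (palette (κ v) (A? v) v)

    L-lists : ∀ v → Unique (L v) × length (L v) ≡ K
    L-lists v = enumeration-list (palette (κ v) (A? v) v) (palette-injective (κ v) (A? v) v)

    L-default : ∀ {v x} → κ v ≡ nothing → ¬ A v → x ∈ L v → x < K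
    L-default {v} κv ¬Av x∈ = let i , e = ∈-enumeration (palette (κ v) (A? v) v) x∈ in
      ≤-trans (s≤s (≤-reflexive e)) (palette-default (A? v) v i κv ¬Av)

    -- The indices of `c` on the coloured vertices are defeated at some `a`: its list is the
    -- transversal of the indices repeated around `a`. So the colour chosen at `a`, say from group
    -- `j`, already appears on `suc K` representatives from that group.
    L-bad : ∀ (c : Fin n → ℕ) → (∀ v → c v ∈ L v) → ∃ λ a → A a ×
      ∃ λ (i : Fin (suc K) → Fin classes) → Injective _≡_ _≡_ i × ∀ q → c (β a (i q)) ≡ c a
    L-bad c c∈L = a , Aa , (λ q → combine j (e q)) ,
      (λ {q} {q′} eq → e-inj (proj₂ (Finₚ.combine-injective j (e q) j (e q′) eq))) , mono
      where
      index : ∀ v → ∃ λ x → ∀ d → κ v ≡ just d → c v ≡ colour (group d) x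
      index v = let i , e = ∈-enumeration (palette (κ v) (A? v) v) (c∈L v)
                    x , h = palette-group (κ v) (A? v) v i
                in x , λ d κv → trans e (h d κv)
      killed = proj₂ killing (proj₁ ∘ index)
      g = proj₁ killed
      a = proj₁ (proj₂ (proj₂ killed))
      Aa = proj₁ (proj₂ (proj₂ (proj₂ killed)))
      transversal : ∃ λ j → c a ≡ colour j (decode (τ a) j)
      transversal = let j , e = ∈-enumeration (palette (κ a) (A? a) a) (c∈L a)
                    in j , trans e (palette-transversal (A? a) a j (plain Aa) Aa)
      j = proj₁ transversal
      maj = frequent {K} {K} (λ i → g (β a (combine j i)))
      e = proj₁ (proj₂ maj)
      e-inj : Injective _≡_ _≡_ e
      e-inj = proj₁ (proj₂ (proj₂ maj))
      open ≡-Reasoning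
      mono : ∀ q → c (β a (combine j (e q))) ≡ c a
      mono q = begin
        c b                                      ≡⟨ proj₂ (index b) d (β-colour Aa d) ⟩
        colour (group d) (proj₁ (index b))       ≡⟨ cong (λ z → colour (proj₁ z) (proj₁ (index b))) (remQuot-combine j (e q)) ⟩
        colour j (proj₁ (index b))               ≡⟨ cong (colour j) (proj₁ (proj₂ killed) b (d , β-colour Aa d)) ⟨
        colour j (g b)                           ≡⟨ cong (colour j) (proj₂ (proj₂ (proj₂ maj)) q) ⟩
        colour j (majority g a j)                ≡⟨ cong (colour j) (finToFun-funToFin (majority g a) j) ⟨
        colour j (decode (encode (majority g a)) j) ≡⟨ cong (λ z → colour j (decode z j)) (proj₂ (proj₂ (proj₂ (proj₂ killed)))) ⟩
        colour j (decode (τ a) j)                ≡⟨ proj₂ transversal ⟨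
        c a                                      ∎
        where
        d = combine j (e q)
        b = β a d

-- `L-default` confines all other vertices to `suc k` colours, so that among `suc (suc k)` of them,
-- such as the middle vertices of two-edge paths, two agree in colour.
record BadLists (k : ℕ) {n m} (κ : Target n m) (A : Fin n → Set) (β : Fin n → Fin m → Fin n) : Set where
  field
    L         : Fin n → List ℕ
    L-lists   : ∀ v → Unique (L v) × length (L v) ≡ suc k
    L-default : ∀ {v x} → κ v ≡ nothing → ¬ A v → x ∈ L v → x < suc k
    L-bad     : ∀ (c : Fin n → ℕ) → (∀ v → c v ∈ L v) → ∃ λ a → A a ×
      ∃ λ (i : Fin (suc (suc k)) → Fin m) → Injective _≡_ _≡_ i × ∀ q → c (β a (i q)) ≡ c a

abstract
  classes-1 ratio : ℕ → ℕ
  classes-1 = Palette.classes-1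
  ratio = Palette.ratio

  bad-lists : ∀ k {n} (κ : Target n (suc (classes-1 k))) {A : Fin n → Set} (A? : Decidable A)
    (β : Fin n → Fin (suc (classes-1 k)) → Fin n) →
    (∀ {a} → A a → κ a ≡ nothing) → (∀ {a} → A a → ∀ c → κ (β a c) ≡ just c) →
    ratio k * # (coloured? κ) < # A? → BadLists k κ A β
  bad-lists k κ A? β plain β-colour large = record
    { L         = Palette.L k κ A? β plain β-colour large
    ; L-lists   = Palette.L-lists k κ A? β plain β-colour large
    ; L-default = Palette.L-default k κ A? β plain β-colour large
    ; L-bad     = Palette.L-bad k κ A? β plain β-colour large
    }

-- Neighbourhood systems made of pairs

Adj : (G : Graph) → Fin (Graph.n G) → Fin (Graph.n G) → Set
Adj G u v = adj G u v ≡ true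

adj? : (G : Graph) → ∀ u → Decidable (Adj G u)
adj? G u v = adj G u v Boolₚ.≟ true

adj-sym : (G : Graph) → ∀ {u v} → Adj G u v → Adj G v u
adj-sym G {u} {v} e = trans (Graph.sym G v u) e

does⇒ : {P : Set} (P? : Dec P) → does P? ≡ true → P
does⇒ (yes p) _ = p
does⇒ (no _) ()

foldr-⊔-upper : (f : Fin n → ℕ) (c : ℕ) → (∀ i → f i ≤ c) → ∀ xs → foldr _⊔_ 0 (map f xs) ≤ c
foldr-⊔-upper f c f≤c []       = z≤n
foldr-⊔-upper f c f≤c (x ∷ xs) = ⊔-lub (f≤c x) (foldr-⊔-upper f c f≤c xs)

foldr-⊔-∈ : (f : Fin n → ℕ) {i : Fin n} → ∀ {xs} → i ∈ xs → f i ≤ foldr _⊔_ 0 (map f xs)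
foldr-⊔-∈ f (here refl) = m≤m⊔n _ _
foldr-⊔-∈ f (there i∈)  = ≤-trans (foldr-⊔-∈ f i∈) (m≤n⊔m _ _)

module PairSystem (G : Graph) {W : Fin (Graph.n G) → Set} (W? : Decidable W) (x y : Fin (Graph.n G) → Fin (Graph.n G))
  (pair : ∀ w → W w → Adj G w (x w) × Adj G w (y w) × x w ≢ y w) where

  private
    V = Fin (Graph.n G)
    member? : (w : V) → Decidable (λ u → W w × (u ≡ x w ⊎ u ≡ y w))
    member? w u = W? w ×-dec ((u Finₚ.≟ x w) ⊎-dec (u Finₚ.≟ y w))

  system : NbhdSystem G
  system = record
    { mem = λ w u → does (member? w u)
    ; sub = λ w u h → neighbour w u (does⇒ (member? w u) h)
    }
    where
    neighbour : ∀ w u → W w × (u ≡ x w ⊎ u ≡ y w) → Adj G w u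
    neighbour w u (Ww , inj₁ refl) = proj₁ (pair w Ww)
    neighbour w u (Ww , inj₂ refl) = proj₁ (proj₂ (pair w Ww))

  private
    size : ∀ w → card (mem system w) ≡ # (member? w)
    size w = trans (card≡# (mem system w)) (sum-cong-≗ step)
      where
      step : ∀ u → ⟦ mem system w u Boolₚ.≟ true ⟧ ≡ ⟦ member? w u ⟧
      step u with does (member? w u)
      ... | true  = refl
      ... | false = refl

    size≤2 : ∀ w → card (mem system w) ≤ 2
    size≤2 w = ≤-trans (≤-reflexive (size w))
      (≤-trans (#-∪ (member? w) (Finₚ._≟ x w) (Finₚ._≟ y w) (λ _ → proj₂))
               (≤-reflexive (cong₂ _+_ (#-≡ (x w)) (#-≡ (y w)))))

    2≤size : ∀ w → W w → 2 ≤ card (mem system w)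
    2≤size w Ww = ≤-trans (≤-reflexive (sym (cong₂ _+_ (#-≡ (x w)) (#-≡ (y w)))))
      (≤-trans (#-⊎ (member? w) (Finₚ._≟ x w) (Finₚ._≟ y w) (λ _ e → Ww , inj₁ e) (λ _ e → Ww , inj₂ e)
                    (λ { _ refl e → proj₂ (proj₂ (pair w Ww)) e }))
               (≤-reflexive (sym (size w))))

  ρ≡2 : ∃ W → ρ system ≡ 2
  ρ≡2 (w , Ww) = ≤-antisym (foldr-⊔-upper (card ∘ mem system) 2 size≤2 (allFin _))
    (≤-trans (2≤size w Ww) (foldr-⊔-∈ (card ∘ mem system) (∈-allFin w)))

  separated : ∀ {c} → IsΣColoring system c → ∀ {w} → W w → c (x w) ≢ c (y w)
  separated valid {w} Ww = valid w (x w) (y w) (dec-true (member? w (x w)) (Ww , inj₁ refl))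
    (dec-true (member? w (y w)) (Ww , inj₂ refl)) (proj₂ (proj₂ (pair w Ww)))

-- Obstructions to star colourings

choice : {X Y : Set} {P : X → Set} (P? : ∀ x → Dec (P x)) {Q : X → Y → Set} → (X → Y) →
         (∀ x → P x → ∃ (Q x)) → ∃ λ (f : X → Y) → ∀ x → P x → Q x (f x)
choice {X} {Y} P? {Q} default h = f , f-spec
  where
  f : X → Y
  f x with P? x
  ... | yes p = proj₁ (h x p)
  ... | no _  = default x
  f-spec : ∀ x → _ → Q x (f x)
  f-spec x p with P? x
  ... | yes p′ = proj₂ (h x p′)
  ... | no ¬p  = contradiction p ¬p

nbrs? : (G : Graph) {M : Fin (Graph.n G) → Set} → Decidable M → ∀ v → Decidable (λ u → Adj G v u × M u)
nbrs? G M? v u = adj? G v u ×-dec M? u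

lists : (G : Graph) (L : Fin (Graph.n G) → List ℕ) → (∀ v → Unique (L v) × length (L v) ≡ k) → ListAssignment G k
lists G L h = L , λ v → proj₁ (h v) , ≤-reflexive (sym (proj₂ (h v)))

representatives : ∀ {C n s} {U A : Fin n → Set} {S : Fin n → Fin n → Set} (R : Rainbow C {n} {s} U A S) →
  ∃ λ (β : Fin n → Fin s → Fin n) → ∀ {a} → Rainbow.A′ R a → ∀ c → S a (β a c) × Rainbow.κ R (β a c) ≡ just c
representatives {n = n} {s} {S = S} R = proj₁ reps , λ {a} Aa → proj₂ reps a Aa
  where
  open Rainbow R
  reps = choice {Fin n} {Fin s → Fin n} A′? {λ a β → ∀ c → S a (β c) × κ (β c) ≡ just c} (λ a _ → a)
                (λ a Aa → (λ c → proj₁ (sees Aa c)) , (λ c → proj₂ (sees Aa c)))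

record BadListsIn (k : ℕ) {n} (U A : Fin n → Set) (S : Fin n → Fin n → Set) : Set where
  field
    L         : Fin n → List ℕ
    L-lists   : ∀ v → Unique (L v) × length (L v) ≡ suc k
    L-default : ∀ {v x} → ¬ U v → ¬ A v → x ∈ L v → x < suc k
    L-bad     : ∀ (c : Fin n → ℕ) → (∀ v → c v ∈ L v) → ∃ λ a → A a × ∃ λ (b : Fin (suc (suc k)) → Fin n) →
      Injective _≡_ _≡_ b × ∀ q → S a (b q) × c (b q) ≡ c a

bad-lists-in : ∀ k {n} {U A : Fin n → Set} {S : Fin n → Fin n → Set} →
  Rainbow (ratio k) {s = suc (classes-1 k)} U A S → BadListsIn k U A S
bad-lists-in k {n} {U} {A} {S} R = record
  { L = L ; L-lists = L-lists
  ; L-default = λ {v} ¬Uv ¬Av → L-default (uncoloured κ v (λ (_ , e) → ¬Uv (κ⊆U e))) (¬Av ∘ A′⊆A)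
  ; L-bad = bad
  }
  where
  open Rainbow R
  reps = representatives R
  β = proj₁ reps
  β-colour : ∀ {a} → A′ a → ∀ c → κ (β a c) ≡ just c
  β-colour Aa c = proj₂ (proj₂ reps Aa c)
  open BadLists (bad-lists k κ A′? β plain β-colour large)
  bad : ∀ (c : Fin n → ℕ) → (∀ v → c v ∈ L v) → ∃ λ a → A a × ∃ λ (b : Fin (suc (suc k)) → Fin n) →
    Injective _≡_ _≡_ b × ∀ q → S a (b q) × c (b q) ≡ c a
  bad c c∈L with L-bad c c∈L
  ... | a , Aa , i , i-inj , mono = a , A′⊆A Aa , β a ∘ i ,
    -- `κ` recovers a class from its representative, so different classes have different
    -- representatives.
    (λ {q} {q′} e → i-inj (just-injective (trans (sym (β-colour Aa (i q))) (trans (cong κ e) (β-colour Aa (i q′)))))) ,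
    (λ q → proj₁ (proj₂ reps Aa (i q)) , mono q)

no-proper-colouring : ∀ k (G : Graph) {U A : Fin (Graph.n G) → Set} {S : Fin (Graph.n G) → Fin (Graph.n G) → Set} →
  (∀ {a u} → S a u → Adj G a u) → BadListsIn k U A S → ¬ ChStar≤ G (suc k)
no-proper-colouring k G S⊆Adj R ch with ch (lists G (BadListsIn.L R) (BadListsIn.L-lists R))
... | c , c∈L , proper , _ with BadListsIn.L-bad R c c∈L
... | a , _ , b , _ , mono = proper a (b zero) (S⊆Adj (proj₁ (mono zero))) (sym (proj₂ (mono zero)))

-- Two-edge paths through removed vertices

module TwoHop (G : Graph) (D : ℕ) {M : Fin (Graph.n G) → Set} (M? : Decidable M)
  (sparse : ∀ w → ¬ M w → # (nbrs? G M? w) ≤ D) where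

  private V = Fin (Graph.n G)

  Via : V → V → V → Set
  Via a u w = ¬ M w × Adj G a w × Adj G u w

  Hop : V → V → Set
  Hop a u = M u × u ≢ a × ∃ (Via a u)

  hop? : ∀ a → Decidable (Hop a)
  hop? a u = M? u ×-dec ¬? (u Finₚ.≟ a) ×-dec any? (λ w → ¬? (M? w) ×-dec adj? G a w ×-dec adj? G u w)

  private
    mids : ∀ a → ∃ λ (f : V → V) → ∀ u → Hop a u → Via a u (f u)
    mids a = choice (hop? a) id (λ u → proj₂ ∘ proj₂)

  ω : V → V → V
  ω a = proj₁ (mids a)

  ω-via : ∀ {a u} → Hop a u → Via a u (ω a u)
  ω-via {a} {u} = proj₂ (mids a) u

  private
    Clash : V → V → V → Set
    Clash a u u′ = Hop a u′ × ω a u ≡ ω a u′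
    clash? : ∀ a u → Decidable (Clash a u)
    clash? a u u′ = hop? a u′ ×-dec (ω a u Finₚ.≟ ω a u′)
    -- Hops sharing a middle vertex are its neighbours in `M`, at most `D` many. The bound is
    -- relaxed to `suc D` to have a positive factor, which can be cancelled later.
    clash≤ : ∀ a u → Hop a u → # (clash? a u) ≤ suc D
    clash≤ a u h = ≤-trans (#-mono (clash? a u) (nbrs? G M? (ω a u)) nbr)
                           (≤-trans (sparse (ω a u) (proj₁ (ω-via h))) (n≤1+n D))
      where
      nbr : ∀ u′ → Clash a u u′ → Adj G (ω a u) u′ × M u′
      nbr u′ (h′ , e) = subst (λ w → Adj G w u′) (sym e) (adj-sym G (proj₂ (proj₂ (ω-via h′)))) , proj₁ h′
    module Private a = Independent (independent (hop? a) (clash? a) (suc D) (λ u h → h , refl) (clash≤ a))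

  -- I a consists of hops from a whose middle vertices ω a u are pairwise distinct.
  open Private public using (I; I?; I-large)

  I⊆Hop : ∀ {a u} → I a u → Hop a u
  I⊆Hop {a} = Private.I⊆A a

  ω-injective : ∀ {a u u′} → I a u → I a u′ → ω a u ≡ ω a u′ → u ≡ u′
  ω-injective {a} i i′ e = Private.apart a i i′ (I⊆Hop i′ , e) (I⊆Hop i , sym e)

-- Around some `a` there are `suc (suc k)` hops with the colour of `a` and different middle
-- vertices. The latter lie outside `M` and have only `suc k` colours, so two of them, `w q` and
-- `w q′`, agree. The path `b q`, `w q`, `a`, `w q′` then has two colours, and its middle edge has
-- no end of degree one.
no-star-colouring : ∀ k D (G : Graph) {M A : Fin (Graph.n G) → Set} (M? : Decidable M)
  (sparse : ∀ w → ¬ M w → # (nbrs? G M? w) ≤ D) → (∀ {a} → A a → M a) →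
  BadListsIn k M A (TwoHop.I G D M? sparse) → ¬ ChStar≤ G (suc k)
no-star-colouring k D G {M} M? sparse A⊆M R ch
  with ch (lists G (BadListsIn.L R) (BadListsIn.L-lists R))
... | c , c∈L , proper , star with BadListsIn.L-bad R c c∈L
... | a , _ , b , b-inj , mono =
  [ (λ leaf → proj₁ (proj₂ (hop q)) (leaf (b q) (inj₁ (proj₂ (mono q))) (adj-sym G (b~w q))))
  , (λ leaf → w-distinct (sym (leaf (w q′) (inj₂ (sym w-mono)) (a~w q′)))) ]′
  (star (c a) (c (w q)) (proper a (w q) (a~w q)) (w q) a (inj₂ refl) (inj₁ refl) (adj-sym G (a~w q)))
  where
  open TwoHop G D M? sparse
  K = suc k
  hop : ∀ q → Hop a (b q)
  hop q = I⊆Hop (proj₁ (mono q))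
  w : Fin (suc K) → Fin (Graph.n G)
  w q = ω a (b q)
  a~w : ∀ q → Adj G a (w q)
  a~w q = proj₁ (proj₂ (ω-via (hop q)))
  b~w : ∀ q → Adj G (b q) (w q)
  b~w q = proj₂ (proj₂ (ω-via (hop q)))
  w∉M : ∀ q → ¬ M (w q)
  w∉M q = proj₁ (ω-via (hop q))
  w-colour : ∀ q → c (w q) < K
  w-colour q = BadListsIn.L-default R (w∉M q) (w∉M q ∘ A⊆M) (c∈L (w q))
  collision = Finₚ.pigeonhole (n<1+n K) (λ q → fromℕ< (w-colour q))
  q q′ : Fin (suc K)
  q  = proj₁ collision
  q′ = proj₁ (proj₂ collision)
  w-mono : c (w q) ≡ c (w q′)
  w-mono = trans (sym (Finₚ.toℕ-fromℕ< (w-colour q)))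
    (trans (cong toℕ (proj₂ (proj₂ (proj₂ collision)))) (Finₚ.toℕ-fromℕ< (w-colour q′)))
  w-distinct : w q ≢ w q′
  w-distinct e = Finₚ.<⇒≢ (proj₁ (proj₂ (proj₂ collision))) (b-inj (ω-injective (proj₁ (mono q)) (proj₁ (mono q′)) e))

-- Obstructions to Σ-colourings

Rho2Choosable : Graph → ℕ → Set
Rho2Choosable G k = (S : NbhdSystem G) → ρ S ≡ 2 → ChΣ≤ S k

pair-ratio : ℕ → ℕ
pair-ratio k = suc k * (suc (suc k) * suc (suc k))

-- With all lists equal to {0, …, k}, any colouring of the coloured vertices repeats a
-- colour on suc (suc k) neighbours of w, and Σ(w) is chosen to be such a pair.
no-dense-Σ : ∀ k (G : Graph) {M A : Fin (Graph.n G) → Set} →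
  Rainbow (pair-ratio k) {s = suc (suc k)} M A (λ v u → Adj G v u × M u) → ¬ Rho2Choosable G (suc k)
no-dense-Σ k G {M} R ch = separated valid Ww (trans (c-index (x w)) (trans (cong toℕ same) (sym (c-index (y w)))))
  where
  V = Fin (Graph.n G)
  s = suc (suc k)
  open Rainbow R
  reps = representatives R
  β = proj₁ reps
  β-spec : ∀ {a} → A′ a → ∀ c → (Adj G a (β a c) × M (β a c)) × κ (β a c) ≡ just c
  β-spec = proj₂ reps
  repeated : (f : V → Fin (suc k)) (a : V) → ∃₂ λ i j → i Fin.< j × f (β a i) ≡ f (β a j)
  repeated f a = Finₚ.pigeonhole (n<1+n (suc k)) (λ i → f (β a i))
  code : (V → Fin (suc k)) → V → Fin (s * s)
  code f a = combine (proj₁ (repeated f a)) (proj₁ (proj₂ (repeated f a)))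
  killing = kill k A′? (coloured? κ) code large
  χ : V → Fin (s * s)
  χ = proj₁ killing
  first second : V → Fin s
  first  w = proj₁ (remQuot {s} s (χ w))
  second w = proj₂ (remQuot {s} s (χ w))
  -- The code `χ w` may also be a diagonal pair, which yields no two distinct neighbours; such `w`
  -- get the empty set.
  W : V → Set
  W w = A′ w × first w ≢ second w
  W? : Decidable W
  W? w = A′? w ×-dec ¬? (first w Finₚ.≟ second w)
  x y : V → V
  x w = β w (first w)
  y w = β w (second w)
  pair : ∀ w → W w → Adj G w (x w) × Adj G w (y w) × x w ≢ y w
  pair w (Aw , i≢j) = proj₁ (proj₁ (β-spec Aw (first w))) , proj₁ (proj₁ (β-spec Aw (second w))) ,
    λ e → i≢j (just-injective (trans (sym (proj₂ (β-spec Aw (first w)))) (trans (cong κ e) (proj₂ (β-spec Aw (second w))))))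
  killed : ∀ (g : V → Fin (suc k)) → ∃ λ w → W w × g (x w) ≡ g (y w)
  killed g with proj₂ killing g
  ... | f , f≡g , a , Aa , code≡χ = a , (Aa , i≢j) ,
      trans (sym (f≡g (x a) (first a , proj₂ (β-spec Aa (first a)))))
        (trans f-same (f≡g (y a) (second a , proj₂ (β-spec Aa (second a)))))
    where
    i = proj₁ (repeated f a)
    j = proj₁ (proj₂ (repeated f a))
    decoded : (i , j) ≡ (first a , second a)
    decoded = trans (sym (remQuot-combine i j)) (cong (remQuot {s} s) code≡χ)
    i≢j : first a ≢ second a
    i≢j e = Finₚ.<⇒≢ (proj₁ (proj₂ (proj₂ (repeated f a))))
      (trans (cong proj₁ decoded) (trans e (sym (cong proj₂ decoded))))
    f-same : f (x a) ≡ f (y a)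
    f-same = subst (λ (i , j) → f (β a i) ≡ f (β a j)) decoded (proj₂ (proj₂ (proj₂ (repeated f a))))
  open PairSystem G W? x y pair
  inhabited : ∃ W
  inhabited = let w , Ww , _ = killed (λ _ → zero) in w , Ww
  colouring = ch system (ρ≡2 inhabited) (lists G (λ _ → enumeration {suc k} toℕ) (λ _ → enumeration-list toℕ toℕ-injective))
  c = proj₁ colouring
  valid : IsΣColoring system c
  valid = proj₂ (proj₂ colouring)
  index : ∀ v → ∃ λ i → c v ≡ toℕ i
  index v = ∈-enumeration toℕ (proj₁ (proj₂ colouring) v)
  c-index : ∀ v → c v ≡ toℕ (proj₁ (index v))
  c-index v = proj₂ (index v)
  result = killed (proj₁ ∘ index)
  w = proj₁ result
  Ww : W w
  Ww = proj₁ (proj₂ result)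
  same : proj₁ (index (x w)) ≡ proj₁ (index (y w))
  same = proj₂ (proj₂ result)

-- A middle vertex `w` can carry only one pair `Σ(w)`, consisting of some `a` and its
-- representative. So `A′` is first thinned to `A″`, whose members have pairwise disjoint sets of
-- middle vertices; the factor `suc (classes-1 k) * suc D` in the hypothesis pays for this. By the
-- bad lists some `a` then agrees with a representative, against the pair at their middle vertex.
no-subdivision-Σ : ∀ k D (G : Graph) {M A : Fin (Graph.n G) → Set} (M? : Decidable M)
  (sparse : ∀ w → ¬ M w → # (nbrs? G M? w) ≤ D) → (∀ {a} → A a → M a) →
  Rainbow (ratio k * (suc (classes-1 k) * suc D)) {s = suc (classes-1 k)} M A (TwoHop.I G D M? sparse) →
  ¬ Rho2Choosable G (suc k)
no-subdivision-Σ k D G {M} {A} M? sparse A⊆M R ch = separated valid Ww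
  (monochromatic (proj₂ (owner w)) (proj₁ own) (proj₂ own) (A″-independent (proj₁ own) Ta (proj₂ own)))
  where
  open TwoHop G D M? sparse
  V = Fin (Graph.n G)
  s = suc (classes-1 k)
  open Rainbow R
  reps = representatives R
  β = proj₁ reps
  β-rep : ∀ {a} → A′ a → ∀ c → I a (β a c)
  β-rep Aa c = proj₁ (proj₂ reps Aa c)
  mid : V → Fin s → V
  mid a c = ω a (β a c)
  Shares : V → V → Set
  Shares a b = A′ b × ∃₂ λ c d → mid a c ≡ mid b d
  shares? : ∀ a → Decidable (Shares a)
  shares? a b = A′? b ×-dec any? (λ c → any? (λ d → mid a c Finₚ.≟ mid b d))
  shares≤ : ∀ a → A′ a → # (shares? a) ≤ s * suc D
  shares≤ a Aa = ≤-trans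
    (#-⋃ (λ _ → yes tt) (λ c → nbrs? G M? (mid a c)) (shares? a) (suc D)
      (λ { b (Ab , c , d , e) → c , tt , subst (λ w → Adj G w b) (sym e) (adj-sym G (proj₁ (proj₂ (ω-via (I⊆Hop (β-rep Ab d)))))) , A⊆M (A′⊆A Ab) })
      (λ c _ → ≤-trans (sparse (mid a c) (proj₁ (ω-via (I⊆Hop (β-rep Aa c))))) (n≤1+n D)))
    (≤-reflexive (cong (_* suc D) (#-all {s} (λ _ → yes tt) (λ _ → tt))))
  open Independent (independent A′? shares? (s * suc D) (λ a Aa → Aa , zero , zero , refl) shares≤)
    using () renaming (I to A″; I? to A″?; I⊆A to A″⊆A′; apart to A″-apart; I-large to A′≤)
  A″-independent : ∀ {a b c d} → A″ a → A″ b → mid a c ≡ mid b d → a ≡ b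
  A″-independent {c = c} {d} Ta Tb e = A″-apart Ta Tb (A″⊆A′ Tb , c , d , e) (A″⊆A′ Ta , d , c , sym e)
  open ≤-Reasoning
  A″-large : ratio k * # (coloured? κ) < # A″?
  A″-large = *-cancelʳ-< (s * suc D) _ _ (begin-strict
    ratio k * # (coloured? κ) * (s * suc D)  ≡⟨ *-assoc (ratio k) _ _ ⟩
    ratio k * (# (coloured? κ) * (s * suc D)) ≡⟨ cong (ratio k *_) (*-comm (# (coloured? κ)) _) ⟩
    ratio k * (s * suc D * # (coloured? κ))  ≡⟨ *-assoc (ratio k) _ _ ⟨
    ratio k * (s * suc D) * # (coloured? κ)  <⟨ large ⟩
    # A′?                                    ≤⟨ A′≤ ⟩
    # A″? * (s * suc D)                       ∎)
  open BadLists (bad-lists k κ A″? β (plain ∘ A″⊆A′) (λ Ta c → proj₂ (proj₂ reps (A″⊆A′ Ta) c)) A″-large)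
  W : V → Set
  W w = ∃₂ λ a c → A″ a × mid a c ≡ w
  W? : Decidable W
  W? w = any? (λ a → any? (λ c → A″? a ×-dec (mid a c Finₚ.≟ w)))
  owners = choice {V} {V × Fin s} W? {λ w (a , c) → A″ a × mid a c ≡ w} (λ w → w , zero) (λ w (a , c , h) → (a , c) , h)
  owner : V → V × Fin s
  owner = proj₁ owners
  owner-spec : ∀ {w} → W w → A″ (proj₁ (owner w)) × mid (proj₁ (owner w)) (proj₂ (owner w)) ≡ w
  owner-spec {w} = proj₂ owners w
  x y : V → V
  x w = proj₁ (owner w)
  y w = β (proj₁ (owner w)) (proj₂ (owner w))
  owned : ∀ {a c w} → A″ a × mid a c ≡ w → Adj G w a × Adj G w (β a c) × a ≢ β a c
  owned {a} {c} (Ta , refl) = let hop = I⊆Hop (β-rep (A″⊆A′ Ta) c) ; _ , a~w , b~w = ω-via hop in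
    adj-sym G a~w , adj-sym G b~w , λ e → proj₁ (proj₂ hop) (sym e)
  pair : ∀ w → W w → Adj G w (x w) × Adj G w (y w) × x w ≢ y w
  pair w Ww = owned (owner-spec Ww)
  open PairSystem G W? x y pair
  inhabited : ∃ W
  inhabited = let a , Ta = 1≤#⇒∃ A″? (≤-trans (s≤s z≤n) A″-large) in mid a zero , a , zero , Ta , refl
  colouring = ch system (ρ≡2 inhabited) (lists G L L-lists)
  c = proj₁ colouring
  valid : IsΣColoring system c
  valid = proj₂ (proj₂ colouring)
  bad = L-bad c (proj₁ (proj₂ colouring))
  a = proj₁ bad
  Ta : A″ a
  Ta = proj₁ (proj₂ bad)
  i = proj₁ (proj₂ (proj₂ bad)) zero
  w = mid a i
  -- The owner chosen for `w` is a priori another pair. Disjointness of the middle sets makes its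
  -- vertex `a`, and injectivity of `ω a` on `I a` gives the same representative.
  monochromatic : ∀ {a′} j → A″ a′ → mid a′ j ≡ w → a′ ≡ a → c a′ ≡ c (β a′ j)
  monochromatic j _ e refl = trans (sym (proj₂ (proj₂ (proj₂ (proj₂ bad))) zero))
    (cong c (sym (ω-injective (β-rep (A″⊆A′ Ta) j) (β-rep (A″⊆A′ Ta) i) e)))
  Ww : W w
  Ww = a , i , Ta , refl
  own : A″ (x w) × mid (x w) (proj₂ (owner w)) ≡ w
  own = owner-spec Ww

-- Greedy colourings along an order

free : (c : Fin n → ℕ) {F : Fin n → Set} (F? : Decidable F) {xs : List ℕ} → Unique xs → # F? < length xs →
       ∃ λ x → x ∈ xs × ∀ u → F u → c u ≢ x
free c F? {x ∷ xs} (x∉ ∷ unique) F<xs with any? (λ u → F? u ×-dec (c u ≟ x))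
... | no ¬hit = x , here refl , λ u Fu e → ¬hit (u , Fu , e)
... | yes (u , Fu , cu≡x) with free c F′? unique (≤-trans F′<F (s≤s⁻¹ F<xs))
  where
  F′? = λ u → F? u ×-dec ¬? (c u ≟ x)
  F′<F : suc (# F′?) ≤ # F?
  F′<F = ≤-trans (≤-reflexive (cong (_+ # F′?) (sym (#-≡ u))))
    (#-⊎ F? (Finₚ._≟ u) F′? (λ { _ refl → Fu }) (λ _ → proj₁) (λ { _ refl (_ , ne) → ne cu≡x }))
... | y , y∈xs , y-free = y , there y∈xs , avoid
  where
  avoid : ∀ u → _ → c u ≢ y
  avoid u Fu e with c u ≟ x
  ... | yes e′ = All.lookup x∉ y∈xs (trans (sym e′) e)
  ... | no ne  = y-free u (Fu , ne) e

abstract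
  -- All vertices at position `N` are coloured in one stage: their conflicts lie strictly earlier
  -- and keep their colours from then on.
  greedy : ∀ {N} (pos : Fin n → ℕ) → (∀ v → pos v < N) → {F : Fin n → Fin n → Set} (F? : ∀ v → Decidable (F v)) →
    (∀ {v u} → F v u → pos u < pos v) → (L : Fin n → List ℕ) → (∀ v → Unique (L v) × # (F? v) < length (L v)) →
    ∃ λ (c : Fin n → ℕ) → (∀ v → c v ∈ L v) × (∀ {v u} → F v u → c u ≢ c v)
  greedy {n} {N} pos pos<N {F} F? F-earlier L L-ok = c , (λ v → proj₁ (c-good v (pos<N v))) , (λ {v} {u} → proj₂ (c-good v (pos<N v)) u)
    where
    Good : (Fin n → ℕ) → Fin n → Set
    Good c v = c v ∈ L v × ∀ u → F v u → c u ≢ c v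
    stage : ∀ N → ∃ λ c → ∀ v → pos v < N → Good c v
    stage zero = (λ _ → 0) , λ v ()
    stage (suc N) with stage N
    ... | c , good = c′ , good′
      where
      fresh : ∀ v → ∃ λ x → x ∈ L v × ∀ u → F v u → c u ≢ x
      fresh v = free c (F? v) (proj₁ (L-ok v)) (proj₂ (L-ok v))
      c′ : Fin n → ℕ
      c′ v = if does (pos v ≟ N) then proj₁ (fresh v) else c v
      old : ∀ {v} → pos v < N → c′ v ≡ c v
      old {v} v<N = cong (if_then proj₁ (fresh v) else c v) (dec-false (pos v ≟ N) (<⇒≢ v<N))
      new : ∀ {v} → pos v ≡ N → c′ v ≡ proj₁ (fresh v)
      new {v} v≡N = cong (if_then proj₁ (fresh v) else c v) (dec-true (pos v ≟ N) v≡N)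
      good′ : ∀ v → pos v < suc N → Good c′ v
      good′ v v<1+N with m≤n⇒m<n∨m≡n (s≤s⁻¹ v<1+N)
      ... | inj₁ v<N = subst (_∈ L v) (sym (old v<N)) (proj₁ (good v v<N)) ,
            λ u Fvu e → proj₂ (good v v<N) u Fvu (trans (sym (old (<-trans (F-earlier Fvu) v<N))) (trans e (old v<N)))
      ... | inj₂ v≡N = subst (_∈ L v) (sym (new v≡N)) (proj₁ (proj₂ (fresh v))) ,
            λ u Fvu e → proj₂ (proj₂ (fresh v)) u Fvu
              (trans (sym (old (≤-trans (F-earlier Fvu) (≤-reflexive v≡N)))) (trans e (new v≡N)))
    c : Fin n → ℕ
    c = proj₁ (stage N)
    c-good : ∀ v → pos v < N → Good c v
    c-good = proj₂ (stage N)

maximum : {Q : Fin n → Set} (Q? : Decidable Q) (f : Fin n → ℕ) →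
          ¬ ∃ Q ⊎ ∃ λ v → Q v × ∀ u → Q u → f u ≤ f v
maximum {zero}  Q? f = inj₁ λ { (() , _) }
maximum {suc n} {Q} Q? f with Q? zero | maximum (Q? ∘ suc) (f ∘ suc)
... | no ¬q₀ | inj₁ ∄Q = inj₁ λ { (zero , q) → ¬q₀ q ; (suc v , q) → ∄Q (v , q) }
... | no ¬q₀ | inj₂ (v , q , max) = inj₂ (suc v , q , λ { zero q₀ → contradiction q₀ ¬q₀ ; (suc u) → max u })
... | yes q₀ | inj₁ ∄Q = inj₂ (zero , q₀ , λ { zero _ → ≤-refl ; (suc u) q → contradiction (u , q) ∄Q })
... | yes q₀ | inj₂ (v , q , max) with ≤-total (f zero) (f (suc v))
...   | inj₁ f₀≤fᵥ = inj₂ (suc v , q , λ { zero _ → f₀≤fᵥ ; (suc u) → max u })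
...   | inj₂ fᵥ≤f₀ = inj₂ (zero , q₀ , λ { zero _ → ≤-refl ; (suc u) q → ≤-trans (max u q) fᵥ≤f₀ })

-- Colourings from an arrangement

module Ordered (G : Graph) (pos : Fin (Graph.n G) → Fin (Graph.n G)) where

  V = Fin (Graph.n G)

  infix 4 _≺_ _≺?_
  _≺_ : V → V → Set
  u ≺ v = toℕ (pos u) < toℕ (pos v)
  _≺?_ : ∀ u v → Dec (u ≺ v)
  u ≺? v = toℕ (pos u) <? toℕ (pos v)

  Before Far : V → V → Set
  Before v u = u ≺ v × Adj G v u
  Far v u = u ≺ v × ∃ λ w → Adj G u w × Adj G v w × v ≺ w

  before? : ∀ v → Decidable (Before v)
  before? v u = u ≺? v ×-dec adj? G v u

  far? : ∀ v → Decidable (Far v)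
  far? v u = u ≺? v ×-dec any? (λ w → adj? G u w ×-dec adj? G v w ×-dec v ≺? w)

  private
    true⇒T : ∀ {b} → b ≡ true → T b
    true⇒T = Equivalence.from Boolₚ.T-≡
    T⇒true : ∀ {b} → T b → b ≡ true
    T⇒true = Equivalence.to Boolₚ.T-≡
    split : ∀ {a b} → T (a ∧ b) → T a × T b
    split = Equivalence.to Boolₚ.T-∧
    pair : ∀ {a b} → T a → T b → T (a ∧ b)
    pair x y = Equivalence.from Boolₚ.T-∧ (x , y)
    common : V → V → V → Bool
    common u v w = adj G u w ∧ adj G v w ∧ (toℕ (pos v) <ᵇ toℕ (pos w))

  backCount≡#far : ∀ v → backCount G pos v ≡ # (far? v)
  backCount≡#far v = trans (card≡# back) (≤-antisym
    (#-mono (λ u → back u Boolₚ.≟ true) (far? v) λ u e →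
      let u≺v , h = split (true⇒T e)
          w , h′ = Any.satisfied (any⁻ (common u v) (allFin _) h)
          uw , h″ = split h′
          vw , v≺w = split {adj G v w} h″
      in <ᵇ⇒< _ _ u≺v , w , T⇒true uw , T⇒true vw , <ᵇ⇒< _ _ v≺w)
    (#-mono (far? v) (λ u → back u Boolₚ.≟ true) λ u (u≺v , w , uw , vw , v≺w) →
      T⇒true (pair (<⇒<ᵇ u≺v) (any⁺ (common u v) (lose (∈-allFin w)
        (pair (true⇒T uw) (pair (true⇒T vw) (<⇒<ᵇ v≺w))))))))
    where
    back : V → Bool
    back u = (toℕ (pos u) <ᵇ toℕ (pos v)) ∧ anyFin (common u v)

module Arranged (G : Graph) {k : ℕ} (arrangement : Arrangeability≤ G k) where

  private
    pos = proj₁ arrangement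
    pos-injective : ∀ {u v} → toℕ (pos u) ≡ toℕ (pos v) → u ≡ v
    pos-injective e = proj₁ (proj₂ arrangement) (toℕ-injective e)

  open Ordered G pos

  far≤ : ∀ v → # (far? v) ≤ k
  far≤ v = ≤-trans (≤-reflexive (sym (backCount≡#far v))) (proj₂ (proj₂ arrangement) v)

  earlier : ∀ {u v} → u ≢ v → u ≺ v ⊎ v ≺ u
  earlier {u} {v} u≢v with <-cmp (toℕ (pos u)) (toℕ (pos v))
  ... | tri< u≺v _ _ = inj₁ u≺v
  ... | tri≈ _ e _   = contradiction (pos-injective e) u≢v
  ... | tri> _ _ v≺u = inj₂ v≺u

  adj⇒≢ : ∀ {u v} → Adj G u v → u ≢ v
  adj⇒≢ {u} uv refl with trans (sym uv) (irrefl G u)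
  ... | ()

  -- All neighbours of v before it, except the last one, are counted at the last one.
  before≤ : ∀ v → # (before? v) ≤ suc k
  before≤ v with maximum (before? v) (toℕ ∘ pos)
  ... | inj₁ ∄ = ≤-trans (≮⇒≥ (λ 1≤ → ∄ (1≤#⇒∃ (before? v) 1≤))) z≤n
  ... | inj₂ (l , (l≺v , vl) , last) = ≤-trans (#-∪ (before? v) (Finₚ._≟ l) (far? l) cases)
      (+-mono-≤ (≤-reflexive (#-≡ l)) (far≤ l))
    where
    cases : ∀ u → Before v u → u ≡ l ⊎ Far l u
    cases u (u≺v , vu) with u Finₚ.≟ l
    ... | yes u≡l = inj₁ u≡l
    ... | no u≢l  = inj₂ (≤∧≢⇒< (last u (u≺v , vu)) (u≢l ∘ pos-injective) , v , adj-sym G vu , adj-sym G vl , l≺v)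

  private
    pos<n : ∀ v → toℕ (pos v) < Graph.n G
    pos<n v = Finₚ.toℕ<n (pos v)

  Mid : V → V → Set
  Mid v u = u ≺ v × ∃ λ w → Before v w × Before w u

  mid? : ∀ v → Decidable (Mid v)
  mid? v u = u ≺? v ×-dec any? (λ w → before? v w ×-dec before? w u)

  -- `Before` makes the colouring proper. The other two exclude equal colours at the ends of a
  -- two-edge path unless its middle vertex comes before both ends.
  StarConflict : V → V → Set
  StarConflict v u = Before v u ⊎ Far v u ⊎ Mid v u

  starConflict? : ∀ v → Decidable (StarConflict v)
  starConflict? v u = before? v u ⊎-dec far? v u ⊎-dec mid? v u

  starConflict≤ : ∀ v → # (starConflict? v) ≤ suc k + (k + suc k * suc k)
  starConflict≤ v = ≤-trans (#-∪ (starConflict? v) (before? v) rest? (λ _ → id))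
    (+-mono-≤ (before≤ v) (≤-trans (#-∪ rest? (far? v) (mid? v) (λ _ → id))
      (+-mono-≤ (far≤ v) (≤-trans
        (#-⋃ (before? v) before? (mid? v) (suc k) (λ u → proj₂) (λ w _ → before≤ w))
        (*-monoˡ-≤ (suc k) (before≤ v))))))
    where
    rest? : Decidable (λ u → Far v u ⊎ Mid v u)
    rest? u = far? v u ⊎-dec mid? v u

  star-colouring : ∀ c → (∀ {v u} → StarConflict v u → c u ≢ c v) → IsStarColoring G c
  star-colouring c separated = proper , star
    where
    proper : IsProper G c
    proper u v uv with earlier (adj⇒≢ uv)
    ... | inj₁ u≺v = separated (inj₁ (u≺v , adj-sym G uv))
    ... | inj₂ v≺u = separated (inj₁ (v≺u , uv)) ∘ sym
    repeated : ∀ {a d b} → Adj G a b → Adj G d b → a ≢ d → c a ≡ c d → b ≺ a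
    repeated {a} {d} {b} ab db a≢d e with earlier (adj⇒≢ ab) | earlier (adj⇒≢ db) | earlier a≢d
    ... | inj₂ b≺a | _        | _        = b≺a
    ... | inj₁ a≺b | inj₁ d≺b | inj₁ a≺d = contradiction e (separated (inj₂ (inj₁ (a≺d , b , ab , db , d≺b))))
    ... | inj₁ a≺b | _        | inj₂ d≺a = contradiction (sym e) (separated (inj₂ (inj₁ (d≺a , b , db , ab , a≺b))))
    ... | inj₁ a≺b | inj₂ b≺d | inj₁ a≺d = contradiction e (separated (inj₂ (inj₂ (a≺d , b , (b≺d , db) , (a≺b , adj-sym G ab)))))
    two : ∀ {i j p q r : ℕ} → p ≡ i ⊎ p ≡ j → q ≡ i ⊎ q ≡ j → r ≡ i ⊎ r ≡ j → p ≢ q → r ≢ q → p ≡ r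
    two (inj₁ refl) _           (inj₁ refl) _   _   = refl
    two (inj₂ refl) _           (inj₂ refl) _   _   = refl
    two (inj₁ refl) (inj₁ refl) _           p≢q _   = contradiction refl p≢q
    two (inj₁ refl) (inj₂ refl) (inj₂ refl) _   r≢q = contradiction refl r≢q
    two (inj₂ refl) (inj₂ refl) _           p≢q _   = contradiction refl p≢q
    two (inj₂ refl) (inj₁ refl) (inj₁ refl) _   r≢q = contradiction refl r≢q
    -- Another neighbour `z` of `y` in these classes has the colour of `x`, so `repeated` would put
    -- `y` before `x`. In two classes every edge thus has its later end as a leaf, and the stars are
    -- centred at their first vertices.
    leaf : ∀ {i j x y} → c x ≡ i ⊎ c x ≡ j → c y ≡ i ⊎ c y ≡ j → Adj G x y → x ≺ y →
           LeafIn G (λ v → c v ≡ i ⊎ c v ≡ j) y x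
    leaf {x = x} {y} Px Py xy x≺y z Pz yz with x Finₚ.≟ z
    ... | yes x≡z = sym x≡z
    ... | no x≢z  = contradiction x≺y (<⇒≯ (repeated xy (adj-sym G yz) x≢z
                      (two Px Py Pz (proper x y xy) (proper z y (adj-sym G yz)))))
    star : ∀ i j → i ≢ j → InducedStarForest G (λ v → c v ≡ i ⊎ c v ≡ j)
    star i j _ x y Px Py xy with earlier (adj⇒≢ xy)
    ... | inj₁ x≺y = inj₂ (leaf Px Py xy x≺y)
    ... | inj₂ y≺x = inj₁ (leaf Py Px (adj-sym G xy) y≺x)

  star-choice : ChStar≤ G (suc (suc k + (k + suc k * suc k)))
  star-choice (L , L-ok) = c , proj₁ (proj₂ colouring) , star-colouring c (proj₂ (proj₂ colouring))
    where
    colouring = greedy (toℕ ∘ pos) pos<n starConflict?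
      (λ { (inj₁ (u≺v , _)) → u≺v ; (inj₂ (inj₁ (u≺v , _))) → u≺v ; (inj₂ (inj₂ (u≺v , _))) → u≺v })
      L (λ v → proj₁ (L-ok v) , ≤-trans (s≤s (starConflict≤ v)) (proj₂ (L-ok v)))
    c = proj₁ colouring

  module _ (S : NbhdSystem G) where

    Member : V → V → Set
    Member w u = mem S w u ≡ true

    member? : ∀ w → Decidable (Member w)
    member? w u = mem S w u Boolₚ.≟ true

    member≤ρ : ∀ w → # (member? w) ≤ ρ S
    member≤ρ w = ≤-trans (≤-reflexive (sym (card≡# (mem S w)))) (foldr-⊔-∈ (card ∘ mem S) (∈-allFin w))

    Near : V → V → Set
    Near v u = u ≺ v × ∃ λ w → Before v w × Member w u

    near? : ∀ v → Decidable (Near v)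
    near? v u = u ≺? v ×-dec any? (λ w → before? v w ×-dec member? w u)

    -- Two members of `Σ(w)` have the common neighbour `w`: if `w` comes after the later one, they
    -- are `Far`; if `w` comes before it, they are `Near`.
    ΣConflict : V → V → Set
    ΣConflict v u = Far v u ⊎ Near v u

    Σconflict? : ∀ v → Decidable (ΣConflict v)
    Σconflict? v u = far? v u ⊎-dec near? v u

    Σconflict≤ : ∀ v → # (Σconflict? v) ≤ k + suc k * ρ S
    Σconflict≤ v = ≤-trans (#-∪ (Σconflict? v) (far? v) (near? v) (λ _ → id))
      (+-mono-≤ (far≤ v) (≤-trans
        (#-⋃ (before? v) member? (near? v) (ρ S) (λ u → proj₂) (λ w _ → member≤ρ w))
        (*-monoˡ-≤ (ρ S) (before≤ v))))

    Σ-choice : 1 ≤ ρ S → ChΣ≤ S ((suc k + suc k) * ρ S)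
    Σ-choice 1≤ρ (L , L-ok) = c , proj₁ (proj₂ colouring) , valid
      where
      open ≤-Reasoning
      enough : suc (k + suc k * ρ S) ≤ (suc k + suc k) * ρ S
      enough = begin
        suc k + suc k * ρ S         ≡⟨ cong (_+ suc k * ρ S) (*-identityʳ (suc k)) ⟨
        suc k * 1 + suc k * ρ S     ≤⟨ +-monoˡ-≤ (suc k * ρ S) (*-monoʳ-≤ (suc k) 1≤ρ) ⟩
        suc k * ρ S + suc k * ρ S   ≡⟨ *-distribʳ-+ (ρ S) (suc k) (suc k) ⟨
        (suc k + suc k) * ρ S       ∎
      colouring = greedy (toℕ ∘ pos) pos<n Σconflict? (λ { (inj₁ (u≺v , _)) → u≺v ; (inj₂ (u≺v , _)) → u≺v })
        L (λ v → proj₁ (L-ok v) , ≤-trans (s≤s (Σconflict≤ v)) (≤-trans enough (proj₂ (L-ok v))))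
      c = proj₁ colouring
      separated : ∀ {v u} → ΣConflict v u → c u ≢ c v
      separated = proj₂ (proj₂ colouring)
      later : ∀ {w u v} → Member w u → Member w v → u ≺ v → c u ≢ c v
      later {w} {u} {v} wu wv u≺v with earlier (adj⇒≢ (sub S w v wv))
      ... | inj₁ w≺v = separated (inj₂ (u≺v , w , (w≺v , adj-sym G (sub S w v wv)) , wu))
      ... | inj₂ v≺w = separated (inj₁ (u≺v , w , adj-sym G (sub S w u wu) , adj-sym G (sub S w v wv) , v≺w))
      valid : IsΣColoring S c
      valid w u v wu wv u≢v with earlier u≢v
      ... | inj₁ u≺v = later wu wv u≺v
      ... | inj₂ v≺u = later wv wu v≺u ∘ sym

-- Building an arrangement from its end

-- The order is built from the last vertex backwards: M is the set of vertices not
-- yet placed, and every vertex outside M comes after all of M.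
module Arrange (G : Graph) (D H : ℕ) where

  private V = Fin (Graph.n G)

  Sparse : {M : V → Set} → Decidable M → Set
  Sparse {M} M? = ∀ w → ¬ M w → # (nbrs? G M? w) ≤ D

  NoDense : Set₁
  NoDense = ∀ {M : V → Set} (M? : Decidable M) (sparse : Sparse M?) → ∃ M →
    ¬ (∀ v → M v → D ≤ # (nbrs? G M? v) ⊎ H ≤ # (TwoHop.hop? G D M? sparse v))

  -- The condition on the position of the common neighbour `w` is void outside `M`, as the vertices
  -- there come after all of `M`.
  Back : (M : V → Set) → (V → ℕ) → V → V → Set
  Back M pos v u = M u × pos u < pos v × ∃ λ w → Adj G u w × Adj G v w × (M w → pos v < pos w)

  back? : ∀ {M} (M? : Decidable M) pos v → Decidable (Back M pos v)
  back? M? pos v u = M? u ×-dec pos u <? pos v ×-dec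
    any? (λ w → adj? G u w ×-dec adj? G v w ×-dec (M? w →-dec (pos v <? pos w)))

  record Arrangement {M} (M? : Decidable M) (N : ℕ) : Set where
    field
      pos     : V → ℕ
      bounded : ∀ {v} → M v → pos v < N
      inj     : ∀ {u v} → M u → M v → pos u ≡ pos v → u ≡ v
      back≤H  : ∀ {v} → M v → # (back? M? pos v) ≤ H

  -- The vertex `l` becomes the last one of `M`. A common neighbour that comes after `l` lies
  -- outside `M`, so the back vertices of `l` are hops. For another vertex of `M` no back vertex is
  -- new: `l` comes after it, and as a common neighbour `l` already counted as later when it was
  -- outside `M′`.
  place : ∀ {N M} (M? : Decidable M) (sparse : Sparse M?) l → # (TwoHop.hop? G D M? sparse l) < H →
          Arrangement (λ v → M? v ×-dec ¬? (v Finₚ.≟ l)) N → Arrangement M? (suc N)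
  place {N} {M} M? sparse l hops<H A′ = record { pos = pos ; bounded = bounded ; inj = inj ; back≤H = λ {v} → back≤H v }
    where
    module A = Arrangement A′
    M′ : V → Set
    M′ v = M v × v ≢ l
    M′? : Decidable M′
    M′? v = M? v ×-dec ¬? (v Finₚ.≟ l)
    pos : V → ℕ
    pos v = if does (v Finₚ.≟ l) then N else A.pos v
    pos-l : pos l ≡ N
    pos-l = cong (if_then N else A.pos l) (dec-true (l Finₚ.≟ l) refl)
    pos-old : ∀ {v} → v ≢ l → pos v ≡ A.pos v
    pos-old {v} v≢l = cong (if_then N else A.pos v) (dec-false (v Finₚ.≟ l) v≢l)
    old<N : ∀ {v} → M v → v ≢ l → pos v < N
    old<N Mv v≢l = ≤-trans (s≤s (≤-reflexive (pos-old v≢l))) (A.bounded (Mv , v≢l))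
    bounded : ∀ {v} → M v → pos v < suc N
    bounded {v} Mv with v Finₚ.≟ l
    ... | yes _  = ≤-refl
    ... | no v≢l = m≤n⇒m≤1+n (A.bounded (Mv , v≢l))
    inj : ∀ {u v} → M u → M v → pos u ≡ pos v → u ≡ v
    inj {u} {v} Mu Mv e with u Finₚ.≟ l | v Finₚ.≟ l
    ... | yes refl | yes refl = refl
    ... | yes _    | no v≢l   = contradiction (sym e) (<⇒≢ (A.bounded (Mv , v≢l)))
    ... | no u≢l   | yes _    = contradiction e (<⇒≢ (A.bounded (Mu , u≢l)))
    ... | no u≢l   | no v≢l   = A.inj (Mu , u≢l) (Mv , v≢l) e
    back≤H : ∀ v → M v → # (back? M? pos v) ≤ H
    back≤H v Mv = cases (v Finₚ.≟ l)
      where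
      cases : Dec (v ≡ l) → # (back? M? pos v) ≤ H
      cases (yes refl) = ≤-trans (#-mono (back? M? pos v) (TwoHop.hop? G D M? sparse v) hop) (<⇒≤ hops<H)
        where
        hop : ∀ u → Back M pos v u → TwoHop.Hop G D M? sparse v u
        hop u (Mu , u<v , w , uw , vw , v<w) = Mu , (λ { refl → <-irrefl refl u<v }) , w ,
          (λ Mw → <⇒≱ (v<w Mw) (≤-trans (s≤s⁻¹ (bounded Mw)) (≤-reflexive (sym pos-l)))) , vw , uw
      cases (no v≢l) = ≤-trans (#-mono (back? M? pos v) (back? M′? A.pos v) old) (A.back≤H (Mv , v≢l))
        where
        old : ∀ u → Back M pos v u → Back M′ A.pos v u
        old u (Mu , u<v , w , uw , vw , v<w) = (Mu , u≢l) , subst₂ _<_ (pos-old u≢l) (pos-old v≢l) u<v , w , uw , vw ,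
          λ (Mw , w≢l) → subst₂ _<_ (pos-old v≢l) (pos-old w≢l) (v<w Mw)
          where
          u≢l : u ≢ l
          u≢l refl = <-asym (≤-trans (≤-reflexive (cong suc (sym pos-l))) u<v) (old<N Mv v≢l)

  arrange : NoDense → ∀ N {M} (M? : Decidable M) → Sparse M? → # M? ≤ N → Arrangement M? N
  arrange no-dense N M? sparse M≤N with any? M?
  ... | no ∄M = record
    { pos = λ _ → 0 ; bounded = λ Mv → contradiction (_ , Mv) ∄M
    ; inj = λ Mu → contradiction (_ , Mu) ∄M ; back≤H = λ Mv → contradiction (_ , Mv) ∄M }
  arrange no-dense zero M? sparse M≤N | yes ∃M = contradiction (≤-trans (∃⇒1≤# M? ∃M) M≤N) λ ()
  arrange no-dense (suc N) {M} M? sparse M≤N | yes ∃M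
    with any? (λ v → M? v ×-dec (# (nbrs? G M? v) <? D ×-dec # (TwoHop.hop? G D M? sparse v) <? H))
  ... | no ∄good = contradiction bad (no-dense M? sparse ∃M)
    where
    bad : ∀ v → M v → D ≤ # (nbrs? G M? v) ⊎ H ≤ # (TwoHop.hop? G D M? sparse v)
    bad v Mv with D ≤? # (nbrs? G M? v) | H ≤? # (TwoHop.hop? G D M? sparse v)
    ... | yes h | _     = inj₁ h
    ... | no _  | yes h = inj₂ h
    ... | no h  | no h′ = contradiction (v , Mv , ≰⇒> h , ≰⇒> h′) ∄good
  ... | yes (l , Ml , nbrs<D , hops<H) =
    place M? sparse l hops<H (arrange no-dense N M′? sparse′ (s≤s⁻¹ (≤-trans M′<M M≤N)))
    where
    M′ : V → Set
    M′ v = M v × v ≢ l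
    M′? : Decidable M′
    M′? v = M? v ×-dec ¬? (v Finₚ.≟ l)
    M′<M : suc (# M′?) ≤ # M?
    M′<M = ≤-trans (≤-reflexive (cong (_+ # M′?) (sym (#-≡ l))))
      (#-⊎ M? (Finₚ._≟ l) M′? (λ { _ refl → Ml }) (λ _ → proj₁) (λ _ e (_ , ne) → ne e))
    fewer : ∀ v → # (nbrs? G M′? v) ≤ # (nbrs? G M? v)
    fewer v = #-mono (nbrs? G M′? v) (nbrs? G M? v) (λ _ (a , m , _) → a , m)
    sparse′ : Sparse M′?
    sparse′ w ¬M′w with w Finₚ.≟ l
    ... | yes refl = ≤-trans (fewer w) (<⇒≤ nbrs<D)
    ... | no w≢l   = ≤-trans (fewer w) (sparse w (λ Mw → ¬M′w (Mw , w≢l)))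

  arrangeability : NoDense → Arrangeability≤ G H
  arrangeability no-dense = position , (λ {u} {v} e → inj tt tt
      (trans (sym (toℕ-position u)) (trans (cong toℕ e) (toℕ-position v)))) ,
      λ v → ≤-trans (≤-reflexive (Ordered.backCount≡#far G position v))
        (≤-trans (#-mono (Ordered.far? G position v) (back? {λ _ → ⊤} (λ _ → yes tt) pos v)
          (λ u (u≺v , w , uw , vw , v≺w) → tt , subst₂ _<_ (toℕ-position u) (toℕ-position v) u≺v , w , uw , vw ,
            λ _ → subst₂ _<_ (toℕ-position v) (toℕ-position w) v≺w)) (back≤H tt))
    where
    open Arrangement (arrange no-dense (Graph.n G) {λ _ → ⊤} (λ _ → yes tt) (λ w ¬tt → contradiction tt ¬tt)
                       (≤-reflexive (#-all (λ _ → yes tt) (λ _ → tt))))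
    position : V → V
    position v = fromℕ< (bounded {v} tt)
    toℕ-position : ∀ v → toℕ (position v) ≡ pos v
    toℕ-position v = Finₚ.toℕ-fromℕ< (bounded tt)

-- The equivalences

larger-half : ∀ {m a b} → 1 ≤ m → m ≤ a + b → (1 ≤ a × m ≤ 2 * a) ⊎ (1 ≤ b × m ≤ 2 * b)
larger-half {m} {a} {b} 1≤m m≤a+b with ≤-total b a
... | inj₁ b≤a = inj₁ (positive a m≤2a , m≤2a)
  where
  positive : ∀ a → m ≤ 2 * a → 1 ≤ a
  positive zero    m≤0 = ≤-trans 1≤m m≤0
  positive (suc _) _   = s≤s z≤n
  m≤2a : m ≤ 2 * a
  m≤2a = ≤-trans m≤a+b (+-monoʳ-≤ a (≤-trans b≤a (≤-reflexive (sym (+-identityʳ a)))))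
... | inj₂ a≤b = inj₂ (positive b m≤2b , m≤2b)
  where
  positive : ∀ b → m ≤ 2 * b → 1 ≤ b
  positive zero    m≤0 = ≤-trans 1≤m m≤0
  positive (suc _) _   = s≤s z≤n
  m≤2b : m ≤ 2 * b
  m≤2b = ≤-trans m≤a+b (+-mono-≤ a≤b (≤-reflexive (sym (+-identityʳ b))))

module _ (G : Graph) (D r : ℕ) where

  private V = Fin (Graph.n G)

  NoDenseHalf NoSubdividedHalf : Set₁
  NoDenseHalf = ∀ {M Q : V → Set} (M? : Decidable M) (Q? : Decidable Q) → 1 ≤ # Q? → # M? ≤ 2 * # Q? →
    ¬ (∀ v → Q v → D ≤ # (nbrs? G M? v))
  NoSubdividedHalf = ∀ {M Q : V → Set} (M? : Decidable M) (Q? : Decidable Q) (sparse : ∀ w → ¬ M w → # (nbrs? G M? w) ≤ D) →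
    (∀ {v} → Q v → M v) → 1 ≤ # Q? → # M? ≤ 2 * # Q? → ¬ (∀ v → Q v → r ≤ # (TwoHop.I? G D M? sparse v))

  -- If no vertex can be removed, every vertex of `M` has many neighbours in `M` or many hops, and
  -- the larger of the two kinds makes up half of `M`. The threshold `r * suc D` for hops leaves `r`
  -- of them with different middle vertices.
  halves⇒arrangeable : NoDenseHalf → NoSubdividedHalf → Arrangeability≤ G (r * suc D)
  halves⇒arrangeable no-dense no-subdivided = Arrange.arrangeability G D (r * suc D) obstruction
    where
    obstruction : Arrange.NoDense G D (r * suc D)
    obstruction {M} M? sparse ∃M bad = [ (λ (1≤ , M≤) → no-dense M? dense? 1≤ M≤ (λ _ → proj₂))
                                       , (λ (1≤ , M≤) → no-subdivided M? hopped? sparse proj₁ 1≤ M≤ (λ v → large v ∘ proj₂)) ]′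
      (larger-half (∃⇒1≤# M? ∃M) (#-∪ M? dense? hopped? (λ v Mv → [ (λ h → inj₁ (Mv , h)) , (λ h → inj₂ (Mv , h)) ]′ (bad v Mv))))
      where
      open TwoHop G D M? sparse
      dense? : Decidable (λ v → M v × D ≤ # (nbrs? G M? v))
      dense? v = M? v ×-dec (D ≤? # (nbrs? G M? v))
      hopped? : Decidable (λ v → M v × r * suc D ≤ # (hop? v))
      hopped? v = M? v ×-dec (r * suc D ≤? # (hop? v))
      large : ∀ v → r * suc D ≤ # (hop? v) → r ≤ # (I? v)
      large v h = *-cancelʳ-≤ r (# (I? v)) (suc D) (≤-trans h (I-large v))

-- Edges and hops lead to the same kind of bad lists, so one threshold `D` serves for both. The 2
-- given to `rainbow` says that `Q` is at least half of `M`.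
star-choice⇒arrangeable : ∀ k → ∃ λ H → ∀ G → ChStar≤ G k → Arrangeability≤ G H
star-choice⇒arrangeable k = D * suc D , λ G ch → halves⇒arrangeable G D D
  (λ M? Q? 1≤Q M≤2Q large → no-proper-colouring k G proj₁
    (bad-lists-in k (rainbow (classes-1 k) 2 (ratio k) M? Q? (nbrs? G M?) 1≤Q M≤2Q large (λ _ _ _ → proj₂)))
    (weaken G ch))
  (λ M? Q? sparse Q⊆M 1≤Q M≤2Q large → let open TwoHop G D M? sparse in no-star-colouring k D G M? sparse Q⊆M
    (bad-lists-in k (rainbow (classes-1 k) 2 (ratio k) M? Q? I? 1≤Q M≤2Q large (λ _ _ _ i → proj₁ (I⊆Hop i))))
    (weaken G ch))
  where
  D = rainbow-degree (classes-1 k) 2 (ratio k)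
  weaken : ∀ G → ChStar≤ G k → ChStar≤ G (suc k)
  weaken G ch (L , L-ok) = ch (L , λ v → proj₁ (L-ok v) , ≤-trans (n≤1+n k) (proj₂ (L-ok v)))

-- The constants are fixed in turn: `D` from the dense case, then `C`, which includes the loss
-- `suc (classes-1 k) * suc D` for disjoint sets of middle vertices, and then the number `r` of
-- hops.
Σ-choice⇒arrangeable : ∀ k → ∃ λ H → ∀ G → Rho2Choosable G k → Arrangeability≤ G H
Σ-choice⇒arrangeable k = r * suc D , λ G ch → halves⇒arrangeable G D r
  (λ M? Q? 1≤Q M≤2Q large → no-dense-Σ k G
    (rainbow (suc k) 2 (pair-ratio k) M? Q? (nbrs? G M?) 1≤Q M≤2Q large (λ _ _ _ → proj₂))
    (weaken G ch))
  (λ M? Q? sparse Q⊆M 1≤Q M≤2Q large → let open TwoHop G D M? sparse in no-subdivision-Σ k D G M? sparse Q⊆M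
    (rainbow (classes-1 k) 2 C M? Q? I? 1≤Q M≤2Q large (λ _ _ _ i → proj₁ (I⊆Hop i)))
    (weaken G ch))
  where
  D = rainbow-degree (suc k) 2 (pair-ratio k)
  C = ratio k * (suc (classes-1 k) * suc D)
  r = rainbow-degree (classes-1 k) 2 C
  weaken : ∀ G → Rho2Choosable G k → Rho2Choosable G (suc k)
  weaken G ch S ρ≡2 (L , L-ok) = ch S ρ≡2 (L , λ v → proj₁ (L-ok v) , ≤-trans (n≤1+n k) (proj₂ (L-ok v)))

module _ (F : GraphClass) where

  star⇒arrangeability : BoundedStarChoice F → BoundedArrangeability F
  star⇒arrangeability (k , ch) = let H , arrangeable = star-choice⇒arrangeable k in
    H , λ G FG → arrangeable G (ch G FG)

  arrangeability⇒star : BoundedArrangeability F → BoundedStarChoice F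
  arrangeability⇒star (k , arr) = _ , λ G FG → Arranged.star-choice G (arr G FG)

  arrangeability⇒linear : BoundedArrangeability F → LinearChBound F
  arrangeability⇒linear (k , arr) = suc k + suc k , λ G FG → Arranged.Σ-choice G (arr G FG)

  -- If ρ(Σ) = 0 then all sets Σ(v) are empty, and a single colour per list suffices.
  linear⇒function : LinearChBound F → FunctionChBound F
  linear⇒function (C , ch) = f , bound
    where
    f : ℕ → ℕ
    f zero    = 1
    f (suc r) = C * suc r
    bound : ∀ G → F G → (S : NbhdSystem G) → ChΣ≤ S (f (ρ S))
    bound G FG S with ρ S | inspect-member | ch G FG S
      where
      inspect-member : ∀ {w u} → mem S w u ≡ true → 1 ≤ ρ S
      inspect-member {w} {u} wu = ≤-trans (∃⇒1≤# (λ u → mem S w u Boolₚ.≟ true) (u , wu))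
        (≤-trans (≤-reflexive (sym (card≡# (mem S w)))) (foldr-⊔-∈ (card ∘ mem S) (∈-allFin w)))
    ... | suc r | _       | ch′ = ch′ (s≤s z≤n)
    ... | zero  | nonzero | _   = λ (L , L-ok) →
      (λ v → proj₁ (pick (L v) (proj₂ (L-ok v)))) , (λ v → proj₂ (pick (L v) (proj₂ (L-ok v)))) ,
      λ w u u′ wu _ _ → contradiction (nonzero wu) λ ()
      where
      pick : ∀ (xs : List ℕ) → 1 ≤ length xs → ∃ (_∈ xs)
      pick (x ∷ xs) _ = x , here refl

  function⇒rho2 : FunctionChBound F → Rho2ChBound F
  function⇒rho2 (f , ch) = f 2 , λ G FG S ρ≡2 → subst (λ r → ChΣ≤ S (f r)) ρ≡2 (ch G FG S)

  rho2⇒arrangeability : Rho2ChBound F → BoundedArrangeability F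
  rho2⇒arrangeability (k , ch) = let H , arrangeable = Σ-choice⇒arrangeable k in
    H , λ G FG → arrangeable G (ch G FG)

theorem8 : (F : GraphClass) →
    (BoundedStarChoice F ⇔ BoundedArrangeability F) ×
    (BoundedArrangeability F ⇔ LinearChBound F) ×
    (LinearChBound F ⇔ FunctionChBound F) ×
    (FunctionChBound F ⇔ Rho2ChBound F)
theorem8 F =
  mk⇔ (star⇒arrangeability F) (arrangeability⇒star F) ,
  mk⇔ (arrangeability⇒linear F) (rho2⇒arrangeability F ∘ function⇒rho2 F ∘ linear⇒function F) ,
  mk⇔ (linear⇒function F) (arrangeability⇒linear F ∘ rho2⇒arrangeability F ∘ function⇒rho2 F) ,
  mk⇔ (function⇒rho2 F) (linear⇒function F ∘ arrangeability⇒linear F ∘ rho2⇒arrangeability F)
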